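{- Let $n\ge 1$ and let $\mathcal{I}^2_n$ be the ideal of $\mathbb{Q}[x_1,y_1,\dots,x_n,y_n]$ generated by all $B$-quasisymmetric polynomials in $x_1,y_1,\dots,x_n,y_n$ with zero constant term. Then $$\dim_{\mathbb{Q}} \mathbb{Q}[x_1,y_1,\dots,x_n,y_n]/\mathcal{I}^2_n=\frac{1}{2n+1}\binom{3n}{n}.$$
   Context: A bivector of size $k$ is a vector $c=(c_1,c_2,\dots,c_{2k})$ of nonnegative integers (odd entries refer to the variables $x$, even entries to the variables $y$). A bicomposition is a bivector with no two consecutive entries both equal to $0$ (i.e. no $c_j=c_{j+1}=0$); the empty bicomposition ($k=0$) is allowed. Write $|c|=c_1+\dots+c_{2k}$. For a bicomposition $c$ of size $k$, the fundamental $B$-quasisymmetric polynomial $F_c(x_1,y_1,\dots,x_n,y_n)$ is defined as follows: split the positions $1,\dots,|c|$ into $2k$ consecutive runs of lengths $c_1,c_2,\dots,c_{2k}$, and group runs $2t-1,2t$ into block $t$ ($t=1,\dots,k$; each block is nonempty). Then $F_c=\sum \prod_{r=1}^{|c|} z_r$, the sum over all sequences $1\le m_1\le m_2\le\dots\le m_{|c|}\le n$ such that $m_r<m_{r+1}$ whenever $r$ is the last position of a block, where $z_r=x_{m_r}$ if position $r$ lies in an odd-indexed run and $z_r=y_{m_r}$ if it lies in an even-indexed run. (E.g. $F_{(1,0,1,2)}=\sum_{i<j\le k\le l}x_ix_jy_ky_l$.) One sets $F_c=0$ if $k>n$, and $F_{\emptyset}=1$. The space $QSym_n(B)$ of $B$-quasisymmetric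 polynomials is the $\mathbb{Q}$-linear span of all $F_c(x_1,y_1,\dots,x_n,y_n)$. -}

module Defs where

open import Data.Nat as ℕ using (ℕ; zero; suc; _∸_)
open import Data.Bool using (Bool; true; false; if_then_else_)
open import Data.List using (List; []; _∷_; _++_; map; concatMap; replicate; upTo; length; foldr)
open import Data.List.Relation.Unary.All using (All)
open import Data.Vec as Vec using (Vec)
import Data.Vec.Properties as VecP
import Data.Product.Properties as ProdP
open import Data.Product using (_×_; _,_; proj₁; proj₂; Σ; ∃)
open import Data.Rational as ℚ using (ℚ; 0ℚ; 1ℚ)
open import Relation.Nullary using (yes; no)
open import Relation.Binary.PropositionalEquality using (_≡_; _≢_)

-- Polynomials in Q[x_1,y_1,...,x_n,y_n]
-- A monomial is a pair (exponents of x_1..x_n , exponents of y_1..y_n).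
-- A polynomial is a finite formal sum of terms (coefficient , monomial);
-- polynomials are compared extensionally via their coefficient functions.

Mono : ℕ → Set
Mono n = Vec ℕ n × Vec ℕ n

one-mono : ∀ {n} → Mono n
one-mono = Vec.replicate _ 0 , Vec.replicate _ 0

mono-mul : ∀ {n} → Mono n → Mono n → Mono n
mono-mul (a , b) (c , d) = Vec.zipWith ℕ._+_ a c , Vec.zipWith ℕ._+_ b d

_≟M_ : ∀ {n} (m m' : Mono n) → Relation.Nullary.Dec (m ≡ m')
_≟M_ = ProdP.≡-dec (VecP.≡-dec ℕ._≟_) (VecP.≡-dec ℕ._≟_)

Poly : ℕ → Set
Poly n = List (ℚ × Mono n)

coeff : ∀ {n} → Poly n → Mono n → ℚ
coeff [] m = 0ℚ
coeff ((c , m') ∷ p) m with m' ≟M m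
... | yes _ = c ℚ.+ coeff p m
... | no _  = coeff p m

_≈P_ : ∀ {n} → Poly n → Poly n → Set
p ≈P q = ∀ m → coeff p m ≡ coeff q m

0P : ∀ {n} → Poly n
0P = []

_+P_ : ∀ {n} → Poly n → Poly n → Poly n
p +P q = p ++ q

scale : ∀ {n} → ℚ → Poly n → Poly n
scale a p = map (λ t → (a ℚ.* proj₁ t , proj₂ t)) p

_-P_ : ∀ {n} → Poly n → Poly n → Poly n
p -P q = p +P scale (ℚ.- 1ℚ) q

_*P_ : ∀ {n} → Poly n → Poly n → Poly n
p *P q = concatMap (λ s → map (λ t → (proj₁ s ℚ.* proj₁ t , mono-mul (proj₂ s) (proj₂ t))) q) p

constTerm : ∀ {n} → Poly n → ℚ
constTerm p = coeff p one-mono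

-- Bivectors and bicompositions
-- A bivector of size k, (c_1,...,c_{2k}), is given as the list of its k
-- blocks (c_{2t-1}, c_{2t}).

Bivector : Set
Bivector = List (ℕ × ℕ)

flatten : Bivector → List ℕ
flatten [] = []
flatten ((a , b) ∷ c) = a ∷ b ∷ flatten c

NoConsecZeros : List ℕ → Set
NoConsecZeros [] = Data.Unit.⊤ where import Data.Unit
NoConsecZeros (a ∷ []) = Data.Unit.⊤ where import Data.Unit
NoConsecZeros (a ∷ b ∷ l) = ((a ≡ 0) × (b ≡ 0) → Data.Empty.⊥) × NoConsecZeros (b ∷ l)
  where import Data.Empty

IsBicomposition : Bivector → Set
IsBicomposition c = NoConsecZeros (flatten c)

data Letter : Set where
  X Y : Letter

markLast : List Letter → List (Letter × Bool)
markLast [] = []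
markLast (l ∷ []) = (l , true) ∷ []
markLast (l ∷ l' ∷ w) = (l , false) ∷ markLast (l' ∷ w)

word : Bivector → List (Letter × Bool)
word [] = []
word ((a , b) ∷ c) = markLast (replicate a X ++ replicate b Y) ++ word c

incAt : ∀ {n} → ℕ → Vec ℕ n → Vec ℕ n
incAt i Vec.[] = Vec.[]
incAt zero (e Vec.∷ v) = suc e Vec.∷ v
incAt (suc i) (e Vec.∷ v) = e Vec.∷ incAt i v

incL : ∀ {n} → Letter → ℕ → Mono n → Mono n
incL X i (a , b) = incAt i a , b
incL Y i (a , b) = a , incAt i b

range : ℕ → ℕ → List ℕ
range lo n = map (lo ℕ.+_) (upTo (n ∸ lo))

-- all monomials z_1 ... z_r for sequences lo ≤ m_1 ≤ m_2 ≤ ... ≤ n-1 with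
-- strict increase after positions marked true
enum : (n : ℕ) → List (Letter × Bool) → ℕ → List (Mono n)
enum n [] lo = one-mono ∷ []
enum n ((l , s) ∷ w) lo =
  concatMap (λ m → map (incL l m) (enum n w (if s then suc m else m))) (range lo n)

F : (n : ℕ) → Bivector → Poly n
F n c = map (λ m → (1ℚ , m)) (enum n (word c) 0)

InQSymB : (n : ℕ) → Poly n → Set
InQSymB n f = ∃ λ (lc : List (ℚ × Σ Bivector IsBicomposition)) →
  f ≈P foldr (λ t acc → scale (proj₁ t) (F n (proj₁ (proj₂ t))) +P acc) 0P lc

Generator : (n : ℕ) → Poly n → Set
Generator n s = InQSymB n s × constTerm s ≡ 0ℚ

InIdeal : (n : ℕ) → Poly n → Set
InIdeal n p = ∃ λ (gs : List (Poly n × Poly n)) →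
  All (λ t → Generator n (proj₂ t)) gs ×
  p ≈P foldr (λ t acc → (proj₁ t *P proj₂ t) +P acc) 0P gs

lincomb : ∀ {n d} → Vec ℚ d → Vec (Poly n) d → Poly n
lincomb Vec.[] Vec.[] = 0P
lincomb (a Vec.∷ as) (b Vec.∷ bs) = scale a b +P lincomb as bs

QuotientDim : (n d : ℕ) → Set
QuotientDim n d = ∃ λ (B : Vec (Poly n) d) →
  (∀ (a : Vec ℚ d) → InIdeal n (lincomb a B) → a ≡ Vec.replicate d 0ℚ) ×
  (∀ (p : Poly n) → ∃ λ (a : Vec ℚ d) → InIdeal n (p -P lincomb a B))

module Submission where

open import Defs
open import Data.Nat using (ℕ; suc; _*_; _≤_; _/_)
open import Data.Nat.Combinatorics using (_C_)

open import Algebra.Properties.Group using (x∙y⁻¹≈ε⇒x≈y)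
open import Data.Bool using (Bool; true; false; if_then_else_)
open import Data.Empty using (⊥; ⊥-elim)
open import Data.Fin using (Fin; zero; suc)
open import Data.List using (List; []; _∷_; _++_; map; replicate; length; concatMap; foldr; upTo)
open import Data.List.Membership.Propositional using (_∈_)
open import Data.List.Membership.Propositional.Properties using (∈-map⁺; ∈-map⁻; ∈-++⁺ˡ; ∈-++⁺ʳ)
open import Data.List.Properties
  using (map-++; map-∘; map-cong; map-applyUpTo; ++-identityʳ; length-++; length-map)
open import Data.List.Relation.Unary.All as All using (All; []; _∷_)
import Data.List.Relation.Unary.All.Properties as All
open import Data.List.Relation.Unary.AllPairs using ([]; _∷_)
open import Data.List.Relation.Unary.Any using (here; there)
open import Data.List.Relation.Unary.Unique.Propositional using (Unique)
import Data.List.Relation.Unary.Unique.Propositional.Properties as Unique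
open import Data.Nat using (zero; _+_; _∸_; _<_; _≤?_; _≡ᵇ_; z≤n; s≤s)
open import Data.Nat.Combinatorics using (nC1≡n; nCk+nC[k+1]≡[n+1]C[k+1]; k>n⇒nCk≡0)
open import Data.Nat.DivMod using (m*n/n≡m)
open import Data.Nat.Induction using (<-rec)
open import Data.Nat.Properties
open import Data.Nat.Tactic.RingSolver using (solve-∀)
open import Data.Product using (_×_; _,_; proj₁; proj₂; ∃)
open import Data.Rational as ℚ using (ℚ; 0ℚ; 1ℚ)
import Data.Rational.Properties as ℚ
open import Data.Rational.Solver using (module +-*-Solver)
open import Data.Unit using (⊤; tt)
open import Data.Vec as Vec using (Vec; []; _∷_)
open import Data.Vec.Properties using (zipWith-identityʳ)
open import Function using (_∘_; id)
open import Relation.Binary.PropositionalEquality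
open import Relation.Nullary using (¬_; yes; no)

open +-*-Solver using (solve; _:+_; _:*_; _:-_; :-_; con; _:=_)

-- List the variables as z₁ , … , z₂ₙ = x₁ , y₁ , … , xₙ , yₙ. A polynomial is B-quasisymmetric iff
-- its coefficients do not change when a pattern (a , 0 , 0) of consecutive exponents is replaced by
-- (0 , 0 , a). A basis of the quotient is given by the monomials z^ν with 2 (ν₁ + … + ν_i) < i for
-- all i, which are counted by a ballot theorem.
--
-- Independence: the operators f ↦ (f(…,z_i,0,0,z_{i+1},…) − f(…,0,0,z_i,z_{i+1},…)) / z_i kill
-- exactly the B-quasisymmetric polynomials, satisfy a twisted Leibniz rule, hence map the ideal for
-- n + 1 to the ideal for n, and they preserve the span of the basis monomials. By induction they
-- kill any element f of the ideal in this span, so f is B-quasisymmetric; moving the first nonzero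
-- exponent to the front gives a monomial outside of the basis, so f is constant, hence 0.
--
-- Spanning: with F_w(j) the fundamental polynomial in z_j , z_{j+1} , …, whose first letter has the
-- parity of j and whose consecutive letters have gaps at least g₁ , g₂ , … ∈ {0 , 1 , 2}, one has
-- F_{gw}(j) = z_j F_w(j + g) + F_{gw}(j + 2). This rewrites every other monomial, modulo the ideal,
-- by monomials that are smaller in the lexicographic order.

-- Exponent vectors and the Dyck condition

infixl 6 _+ᵥ_
_+ᵥ_ : ∀ {m} → Vec ℕ m → Vec ℕ m → Vec ℕ m
_+ᵥ_ = Vec.zipWith _+_

bump : ∀ {m} → Vec ℕ (suc m) → Vec ℕ (suc m)
bump (a ∷ v) = suc a ∷ v

-- `h` is the height of a lattice path: each unit of an exponent costs 2, passing to the next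
-- position gains 1, and the height may not become negative. For `h = 0` these are the inequalities
-- 2 (ν₁ + ... + ν_i) < i.
Dyck : ∀ {m} → ℕ → Vec ℕ m → Set
Dyck h []                          = ⊤
Dyck h (zero ∷ v)                  = Dyck (suc h) v
Dyck zero (suc e ∷ v)              = ⊥
Dyck (suc zero) (suc e ∷ v)        = ⊥
Dyck (suc (suc h)) (suc e ∷ v)     = Dyck h (e ∷ v)

-- Counting

dyckVectors : (m h : ℕ) → List (Vec ℕ m)
dyckVectors zero    h             = [] ∷ []
dyckVectors (suc m) zero          = map (0 ∷_) (dyckVectors m 1)
dyckVectors (suc m) (suc zero)    = map (0 ∷_) (dyckVectors m 2)
dyckVectors (suc m) (suc (suc h)) = map (0 ∷_) (dyckVectors m (3 + h)) ++ map bump (dyckVectors (suc m) h)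

-- The heights are shifted by 2, so that there are no vectors at the negative heights −2 and −1.
count : ℕ → ℕ → ℕ
count m       zero          = 0
count m       (suc zero)    = 0
count zero    (suc (suc h)) = 1
count (suc m) (suc (suc h)) = count m (3 + h) + count (suc m) h

length-dyckVectors : ∀ m h → length (dyckVectors m h) ≡ count m (2 + h)
length-dyckVectors zero    h             = refl
length-dyckVectors (suc m) zero          = trans (length-map _ (dyckVectors m 1))
  (trans (length-dyckVectors m 1) (sym (+-identityʳ _)))
length-dyckVectors (suc m) (suc zero)    = trans (length-map _ (dyckVectors m 2))
  (trans (length-dyckVectors m 2) (sym (+-identityʳ _)))
length-dyckVectors (suc m) (suc (suc h)) = trans (length-++ (map (0 ∷_) (dyckVectors m (3 + h))))
  (cong₂ _+_ (trans (length-map _ (dyckVectors m (3 + h))) (length-dyckVectors m (3 + h)))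
             (trans (length-map _ (dyckVectors (suc m) h)) (length-dyckVectors (suc m) h)))

-- ballot J S counts the vectors ν of length J with ν₁ + … + ν_J = S and 2 (ν₁ + … + ν_i) < i for all i.
ballot : ℕ → ℕ → ℕ
ballot zero    zero    = 1
ballot zero    (suc S) = 0
ballot (suc J) zero    = 1
ballot (suc J) (suc S) with suc S * 2 ≤? J
... | yes _ = ballot J (suc S) + ballot (suc J) S
... | no  _ = 0

ballot-0 : ∀ J → ballot J 0 ≡ 1
ballot-0 zero    = refl
ballot-0 (suc J) = refl

ballot-inside : ∀ {J S} → suc S * 2 ≤ J → ballot (suc J) (suc S) ≡ ballot J (suc S) + ballot (suc J) S
ballot-inside {J} {S} le with suc S * 2 ≤? J
... | yes _ = refl
... | no ¬p = ⊥-elim (¬p le)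

ballot-outside : ∀ {J S} → J < suc S * 2 → ballot J (suc S) ≡ 0
ballot-outside {zero}  lt = refl
ballot-outside {suc J} {S} lt with suc S * 2 ≤? J
... | yes p = ⊥-elim (<-irrefl refl (≤-trans (m≤n⇒m≤1+n (s≤s p)) lt))
... | no _  = refl

∑≤ : ℕ → (ℕ → ℕ) → ℕ
∑≤ zero    f = f 0
∑≤ (suc K) f = ∑≤ K f + f (suc K)

∑≤-zero : ∀ K f → (∀ S → f (suc S) ≡ 0) → ∑≤ K f ≡ f 0
∑≤-zero zero    f z = refl
∑≤-zero (suc K) f z = trans (cong₂ _+_ (∑≤-zero K f z) (z K)) (+-identityʳ _)

-- Classify the vectors of length J + 1 and sum K by the sum S of the first J entries. The last
-- entry is then K - S, and its inequality 2K < J + 1 is the hypothesis.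
∑≤-ballot : ∀ J K → K * 2 ≤ J → ∑≤ K (ballot J) ≡ ballot (suc J) K
∑≤-ballot J zero    le = ballot-0 J
∑≤-ballot J (suc K) le = trans (cong (_+ ballot J (suc K)) (∑≤-ballot J K (≤-trans (m≤n+m _ 2) le)))
  (trans (+-comm (ballot (suc J) K) _) (sym (ballot-inside le)))

-- Vectors are cut after their first J entries: a prefix of sum S ends at height J - 2S, where the
-- other m entries start. The summand 2 is the shift in `count`.
cut : ℕ → ℕ → ℕ → ℕ
cut m J K = ∑≤ K (λ S → ballot J S * count m (2 + J ∸ S * 2))

≡⇒∸ : ∀ {a b h} → a ≡ b + h → a ∸ b ≡ h
≡⇒∸ {b = b} {h} refl = m+n∸m≡n b h

-- Abel summation: ballot J and count m are the differences of ballot (suc J) and count (suc m).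
cut-suc : ∀ m J K →
  cut m (suc J) K + ballot (suc J) K * count (suc m) (J ∸ K * 2) ≡ cut (suc m) J K
cut-suc m J zero rewrite ballot-0 J = lem (count m (3 + J)) (count (suc m) J)
  where lem : ∀ a b → 1 * a + 1 * b ≡ 1 * (a + b)
        lem = solve-∀
cut-suc m J (suc K) with suc K * 2 ≤? J
... | no 2K+2≰J rewrite ballot-outside {J} {K} (≰⇒> 2K+2≰J) =
  begin
    (cut m (suc J) K + 0) + 0                                                ≡⟨ lem _ ⟩
    cut m (suc J) K + 0                                                      ≡⟨ cong (cut m (suc J) K +_) (sym vanish) ⟩
    cut m (suc J) K + ballot (suc J) K * count (suc m) (J ∸ K * 2)           ≡⟨ cut-suc m J K ⟩
    cut (suc m) J K                                                          ≡⟨ sym (+-identityʳ _) ⟩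
    cut (suc m) J K + 0                                                      ∎
  where
  open ≡-Reasoning
  lem : ∀ a → (a + 0) + 0 ≡ a + 0
  lem = solve-∀
  -- Here J ≤ 2K + 1, so `J ∸ K * 2` encodes a negative height and the boundary term vanishes.
  small : ∀ k → k ≤ 1 → count (suc m) k ≡ 0
  small zero    _ = refl
  small (suc zero) _ = refl
  small (suc (suc k)) (s≤s ())
  vanish : ballot (suc J) K * count (suc m) (J ∸ K * 2) ≡ 0
  vanish = trans (cong (ballot (suc J) K *_) (small (J ∸ K * 2)
    (≤-trans (∸-monoˡ-≤ (K * 2) (≤-pred (≰⇒> 2K+2≰J))) (≤-reflexive (≡⇒∸ (+-comm 1 (K * 2)))))))
    (*-zeroʳ (ballot (suc J) K))
... | yes 2K+2≤J = begin
    (cut m (suc J) K + (x + y) * count m (3 + J ∸ suc K * 2)) + (x + y) * count (suc m) (J ∸ suc K * 2)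
  ≡⟨ cong (λ a → (cut m (suc J) K + (x + y) * count m a) + (x + y) * count (suc m) h) e₁ ⟩
    (cut m (suc J) K + (x + y) * count m (3 + h)) + (x + y) * count (suc m) h
  ≡⟨ lem (cut m (suc J) K) x y (count m (3 + h)) (count (suc m) h) ⟩
    (cut m (suc J) K + y * count (suc m) (2 + h)) + x * count (suc m) (2 + h)
  ≡⟨ cong (λ a → (cut m (suc J) K + y * count (suc m) a) + x * count (suc m) (2 + h)) (sym e₂) ⟩
    (cut m (suc J) K + y * count (suc m) (J ∸ K * 2)) + x * count (suc m) (2 + h)
  ≡⟨ cong₂ (λ a b → a + x * count (suc m) b) (cut-suc m J K) (sym e₃) ⟩
    cut (suc m) J K + x * count (suc m) (2 + J ∸ suc K * 2) ∎
  where
  open ≡-Reasoning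
  x = ballot J (suc K)
  y = ballot (suc J) K
  h = J ∸ suc K * 2
  J≡ : J ≡ suc K * 2 + h
  J≡ = sym (m+[n∸m]≡n 2K+2≤J)
  shuffle : ∀ a b c → a + (b + c) ≡ b + (a + c)
  shuffle = solve-∀
  e₁ : 3 + J ∸ suc K * 2 ≡ 3 + h
  e₁ = ≡⇒∸ {b = suc K * 2} (trans (cong (3 +_) J≡) (shuffle 3 (suc K * 2) h))
  e₂ : J ∸ K * 2 ≡ 2 + h
  e₂ = ≡⇒∸ {b = K * 2} (trans J≡ (shuffle 2 (K * 2) h))
  e₃ : 2 + J ∸ suc K * 2 ≡ 2 + h
  e₃ = ≡⇒∸ {b = suc K * 2} (trans (cong (2 +_) J≡) (shuffle 2 (suc K * 2) h))
  lem : ∀ c x y a b → (c + (x + y) * a) + (x + y) * b ≡ (c + y * (a + b)) + x * (a + b)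
  lem = solve-∀

cut-step : ∀ m J K → J ≤ K * 2 → cut m (suc J) K ≡ cut (suc m) J K
cut-step m J K le = trans (sym (trans
  (cong (λ d → cut m (suc J) K + ballot (suc J) K * count (suc m) d) (m≤n⇒m∸n≡0 le))
  (trans (cong (cut m (suc J) K +_) (*-zeroʳ (ballot (suc J) K))) (+-identityʳ _))))
  (cut-suc m J K)

cut-invariant : ∀ m J K → m + J ≤ K * 2 → cut 0 (m + J) K ≡ cut m J K
cut-invariant zero    J K le = refl
cut-invariant (suc m) J K le = trans (cong (λ j → cut 0 j K) (sym (+-suc m J)))
  (trans (cut-invariant m (suc J) K (subst (_≤ K * 2) (sym (+-suc m J)) le))
         (cut-step m J K (≤-trans (m≤n+m J (suc m)) le)))

count-positive : ∀ J K → K * 2 ≤ J → count 0 (2 + J ∸ K * 2) ≡ 1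
count-positive J K le = cong (count 0) {y = 2 + (J ∸ K * 2)} (+-∸-assoc 2 le)

-- Move the cut from the front to the end. At the front only S = 0 contributes; at the end every
-- factor `count 0` is 1, and the ballot numbers add up to the one for vectors with one more entry.
count≡ballot : ∀ n → count (n * 2) 2 ≡ ballot (suc (n * 2)) n
count≡ballot n = begin
  count (n * 2) 2                      ≡⟨ sym (+-identityʳ _) ⟩
  1 * count (n * 2) 2                  ≡⟨ sym (∑≤-zero n _ (λ _ → refl)) ⟩
  cut (n * 2) 0 n                      ≡⟨ sym (cut-invariant (n * 2) 0 n (≤-reflexive (+-identityʳ _))) ⟩
  cut 0 (n * 2 + 0) n                  ≡⟨ cong (λ J → cut 0 J n) (+-identityʳ (n * 2)) ⟩
  cut 0 (n * 2) n                      ≡⟨ final n ≤-refl ⟩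
  ∑≤ n (ballot (n * 2))                ≡⟨ ∑≤-ballot (n * 2) n ≤-refl ⟩
  ballot (suc (n * 2)) n               ∎
  where
  open ≡-Reasoning
  term : ∀ K → K ≤ n → ballot (n * 2) K * count 0 (2 + n * 2 ∸ K * 2) ≡ ballot (n * 2) K
  term K le = trans (cong (ballot (n * 2) K *_) (count-positive (n * 2) K (*-monoˡ-≤ 2 le))) (*-identityʳ _)
  final : ∀ K → K ≤ n → cut 0 (n * 2) K ≡ ∑≤ K (ballot (n * 2))
  final zero    le = term 0 le
  final (suc K) le = cong₂ _+_ (final K (≤-trans (n≤1+n K) le)) (term (suc K) le)

-- Binomial formula for the ballot numbers

absorption : ∀ n k → suc k * (n C suc k) + k * (n C k) ≡ n * (n C k)
absorption zero    zero    = refl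
absorption zero    (suc k) rewrite k>n⇒nCk≡0 {0} {suc k} (s≤s z≤n) | k>n⇒nCk≡0 {0} {suc (suc k)} (s≤s z≤n) =
  lem k
  where lem : ∀ k → suc (suc k) * 0 + suc k * 0 ≡ 0
        lem = solve-∀
absorption (suc n) zero    = trans (cong (λ a → 1 * a + 0) (nC1≡n (suc n))) (lem n)
  where lem : ∀ n → 1 * suc n + 0 ≡ suc n * 1
        lem = solve-∀
absorption (suc n) (suc k)
  rewrite sym (nCk+nC[k+1]≡[n+1]C[k+1] n (suc k)) | sym (nCk+nC[k+1]≡[n+1]C[k+1] n k) =
  trans (lem₁ k (n C k) (n C suc k) (n C suc (suc k)))
  (trans (cong₂ (λ a b → a + b + (n C suc k) + (n C k)) (absorption n (suc k)) (absorption n k))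
         (lem₂ n (n C k) (n C suc k)))
  where
  lem₁ : ∀ k a b c → suc (suc k) * (b + c) + suc k * (a + b) ≡
                     (suc (suc k) * c + suc k * b) + (suc k * b + k * a) + b + a
  lem₁ = solve-∀
  lem₂ : ∀ n a b → n * b + n * a + b + a ≡ suc n * (a + b)
  lem₂ = solve-∀

_Cpred_ : ℕ → ℕ → ℕ
n Cpred zero  = 0
n Cpred suc k = n C k

pascal : ∀ n k → n Cpred k + n C k ≡ suc n C k
pascal n zero    = refl
pascal n (suc k) = nCk+nC[k+1]≡[n+1]C[k+1] n k

-- On the line J + 1 = 2S, where S = s + 1, the ballot number is 0 and its formula must vanish as
-- well. This is absorption with N - s = 2 (s + 1).
C-boundary : ∀ s → 2 * ((suc s * 2 ∸ 1 + suc s) C s) ≡ (suc s * 2 ∸ 1 + suc s) C suc s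
C-boundary s = *-cancelˡ-≡ _ _ (suc s) (+-cancelʳ-≡ (s * (N C s)) _ _
  (trans (lem s (N C s)) (sym (absorption N s))))
  where
  N = suc s * 2 ∸ 1 + suc s
  lem : ∀ s c → suc s * (2 * c) + s * c ≡ (suc (s * 2) + suc s) * c
  lem = solve-∀

-- Both sides obey the same Pascal recurrence when 2S ≤ J, and `C-boundary` settles 2S = J + 1. The
-- negative term of the formula stands on the left to stay within ℕ.
ballot-formula : ∀ J S → S * 2 ≤ suc J → ballot (suc J) S + 2 * ((J + S) Cpred S) ≡ (J + S) C S
ballot-formula J zero    le = refl
ballot-formula J (suc S) le with suc S * 2 ≤? J
ballot-formula J       (suc S) le | no 2S+2≰J with ≤-antisym le (≰⇒> 2S+2≰J)
... | refl = C-boundary S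
ballot-formula zero    (suc S) le | yes ()
ballot-formula (suc J) (suc S) le | yes 2S+2≤J = begin
    x + y + 2 * ((suc J + suc S) C S)
  ≡⟨ cong (λ c → x + y + 2 * c) (sym (pascal (J + suc S) S)) ⟩
    x + y + 2 * (M Cpred S + M C S)
  ≡⟨ lem x y (M Cpred S) (M C S) ⟩
    (y + 2 * (M Cpred S)) + (x + 2 * (M C S))
  ≡⟨ cong₂ _+_ (subst (λ k → y + 2 * (k Cpred S) ≡ k C S) (sym (+-suc J S))
                 (ballot-formula (suc J) S (≤-trans (m≤n+m _ 2) (m≤n⇒m≤1+n 2S+2≤J))))
               (ballot-formula J (suc S) 2S+2≤J) ⟩
    M C S + M C suc S
  ≡⟨ pascal M (suc S) ⟩
    (suc J + suc S) C suc S ∎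
  where
  open ≡-Reasoning
  M = J + suc S
  x = ballot (suc J) (suc S)
  y = ballot (suc (suc J)) S
  lem : ∀ x y a b → x + y + 2 * (a + b) ≡ (y + 2 * a) + (x + 2 * b)
  lem = solve-∀

-- With N = 3n the formula reads b = C(N, n) - 2 C(N, n - 1), while n C(N, n) = (2n + 1) C(N, n -
-- 1). Multiplying b by 2n + 1 leaves (2n + 1 - 2n) C(N, n).
ballot-ternary : ∀ n → ballot (suc (n * 2)) n * suc (2 * n) ≡ (3 * n) C n
ballot-ternary zero    = refl
ballot-ternary (suc s) = begin
  b * suc (2 * n)                     ≡⟨ +-cancelʳ-≡ (2 * (n * (N C n))) _ _ main ⟩
  N C n                               ≡⟨ cong (_C n) (N≡ s) ⟩
  (3 * n) C n                         ∎
  where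
  open ≡-Reasoning
  n = suc s
  N = n * 2 + n
  b = ballot (suc (n * 2)) n
  N≡ : ∀ s → suc s * 2 + suc s ≡ 3 * suc s
  N≡ = solve-∀
  absorbed : n * (N C n) ≡ suc (2 * n) * (N C s)
  absorbed = +-cancelʳ-≡ (s * (N C s)) _ _ (trans (absorption N s) (lem s (N C s)))
    where lem : ∀ s c → (suc s * 2 + suc s) * c ≡ suc (2 * suc s) * c + s * c
          lem = solve-∀
  main : b * suc (2 * n) + 2 * (n * (N C n)) ≡ N C n + 2 * (n * (N C n))
  main = begin
    b * suc (2 * n) + 2 * (n * (N C n))              ≡⟨ cong (λ c → b * suc (2 * n) + 2 * c) absorbed ⟩
    b * suc (2 * n) + 2 * (suc (2 * n) * (N C s))    ≡⟨ lem₁ b n (N C s) ⟩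
    suc (2 * n) * (b + 2 * (N C s))                  ≡⟨ cong (suc (2 * n) *_) (ballot-formula (n * 2) n (n≤1+n _)) ⟩
    suc (2 * n) * (N C n)                            ≡⟨ lem₂ n (N C n) ⟩
    N C n + 2 * (n * (N C n))                        ∎
    where
    lem₁ : ∀ b n c → b * suc (2 * n) + 2 * (suc (2 * n) * c) ≡ suc (2 * n) * (b + 2 * c)
    lem₁ = solve-∀
    lem₂ : ∀ n c → suc (2 * n) * c ≡ c + 2 * (n * c)
    lem₂ = solve-∀

length-dyckVectors-ternary : ∀ n → length (dyckVectors (n * 2) 0) ≡ ((3 * n) C n) / suc (2 * n)
length-dyckVectors-ternary n = begin
  length (dyckVectors (n * 2) 0)                             ≡⟨ length-dyckVectors (n * 2) 0 ⟩
  count (n * 2) 2                                            ≡⟨ count≡ballot n ⟩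
  ballot (suc (n * 2)) n                                     ≡⟨ sym (m*n/n≡m _ (suc (2 * n))) ⟩
  ballot (suc (n * 2)) n * suc (2 * n) / suc (2 * n)         ≡⟨ cong (_/ suc (2 * n)) (ballot-ternary n) ⟩
  ((3 * n) C n) / suc (2 * n)                                ∎
  where open ≡-Reasoning

-- Spanning

data Gap : Set where
  g0 g1 g2 : Gap

gap : Gap → ℕ
gap g0 = 0
gap g1 = 1
gap g2 = 2

slack : Gap → ℕ
slack g0 = 2
slack g1 = 1
slack g2 = 0

-- A letter costs height 2 and the following gap g regains `gap g`, so `weight w` is the total loss
-- of height when the letters of w are placed as tightly as possible.
weight : List Gap → ℕ
weight []      = 0
weight (g ∷ w) = slack g + weight w

-- The monomials of F_w, the first letter standing at position d, d + 2, d + 4, ... . Each letter is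
-- stored with the gap behind it; skipping a position sets the delay to 1, which preserves parity.
fund : List Gap → ℕ → (m : ℕ) → List (Vec ℕ m)
fund []      d       m       = Vec.replicate m 0 ∷ []
fund (g ∷ w) d       zero    = []
fund (g ∷ w) zero    (suc m) = map bump (fund w (gap g) (suc m)) ++ map (0 ∷_) (fund (g ∷ w) 1 m)
fund (g ∷ w) (suc d) (suc m) = map (0 ∷_) (fund (g ∷ w) d m)

fund-suc : ∀ w d m → fund w (suc d) (suc m) ≡ map (0 ∷_) (fund w d m)
fund-suc []      d m = refl
fund-suc (g ∷ w) d m = refl

-- Lists stand for sums of monomials. The fields imitate membership in a subspace, with cancellation
-- in place of subtraction.
record Additive {m} (N : List (Vec ℕ m) → Set) : Set where
  field
    nil     : N []
    add     : ∀ p q → N p → N q → N (p ++ q)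
    cancelˡ : ∀ p q → N (p ++ q) → N p → N q
    cancelʳ : ∀ p q → N (p ++ q) → N q → N p

  all : (p : List (Vec ℕ m)) → (∀ v → N (v ∷ [])) → N p
  all []      f = nil
  all (v ∷ p) f = add (v ∷ []) p (f v) (all p f)

open Additive

prefixed : ∀ {m} {N : List (Vec ℕ (suc m)) → Set} (e : ℕ) → Additive N → Additive (N ∘ map (e ∷_))
prefixed {N = N} e A = record
  { nil     = nil A
  ; add     = λ p q x y → subst N (sym (map-++ _ p q)) (add A _ _ x y)
  ; cancelˡ = λ p q x y → cancelˡ A _ _ (subst N (map-++ _ p q) x) y
  ; cancelʳ = λ p q x y → cancelʳ A _ _ (subst N (map-++ _ p q) x) y
  }

shift-bump : ∀ {m} a (α : Vec ℕ m) p →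
  map ((a ∷ α) +ᵥ_) (map bump p) ≡ map ((suc a ∷ α) +ᵥ_) p
shift-bump a α p = trans (sym (map-∘ p))
  (map-cong (λ { (b ∷ β) → cong (_∷ (α +ᵥ β)) (+-suc a b) }) p)

shift-0∷ : ∀ {m} a (α : Vec ℕ m) p →
  map ((a ∷ α) +ᵥ_) (map (0 ∷_) p) ≡ map (a ∷_) (map (α +ᵥ_) p)
shift-0∷ a α p = trans (sym (map-∘ p)) (trans
  (map-cong (λ β → cong (_∷ (α +ᵥ β)) (+-identityʳ a)) p) (map-∘ p))

-- This is the recursion F_{gw}(j) = z_j F_w(j + g) + F_{gw}(j + 2) times a monomial: the first term
-- raises the first exponent, the second keeps it.
shift-fund : ∀ {m} a (α : Vec ℕ m) g w →
  map ((a ∷ α) +ᵥ_) (fund (g ∷ w) 0 (suc m)) ≡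
  map ((suc a ∷ α) +ᵥ_) (fund w (gap g) (suc m)) ++ map (a ∷_) (map (α +ᵥ_) (fund (g ∷ w) 1 m))
shift-fund a α g w = trans (map-++ _ (map bump (fund w (gap g) _)) _)
  (cong₂ _++_ (shift-bump a α (fund w (gap g) _)) (shift-0∷ a α (fund (g ∷ w) 1 _)))

Dyck-cons : ∀ {m} e k (v : Vec ℕ m) → Dyck (suc k) v → Dyck (e * 2 + k) (e ∷ v)
Dyck-cons zero    k v d = d
Dyck-cons (suc e) k v d = Dyck-cons e k v d

weight-g0 : ∀ e w → weight (replicate e g0 ++ w) ≡ e * 2 + weight w
weight-g0 zero    w = refl
weight-g0 (suc e) w = cong (2 +_) (weight-g0 e w)

-- For `t = suc h` the bound forces the tightest placement of w, started at height h, below 0. So N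
-- contains the multiples of those F_w whose leading monomial is not Dyck.
ContainsFund : ∀ {m} → ℕ → (List (Vec ℕ m) → Set) → Set
ContainsFund {m} t N = ∀ α w g → gap g ≤ 1 → gap g + t ≤ weight w → N (map (α +ᵥ_) (fund w (gap g) m))

module Peel {m} (h : ℕ) (N : List (Vec ℕ (suc m)) → Set) (A : Additive N)
            (K : ContainsFund (suc h) N) where

  -- Gap 2 is reached by solving the recursion for F_{gw}(j + 2). The bound passes to the subtracted
  -- term because `gap g` and `slack g` add up to 2.
  all-gaps : ∀ α w g → gap g + suc h ≤ weight w → N (map (α +ᵥ_) (fund w (gap g) (suc m)))
  all-gaps α w g0 le = K α w g0 z≤n le
  all-gaps α w g1 le = K α w g1 (s≤s z≤n) le
  all-gaps (a ∷ α) (g ∷ w) g2 le = subst N (sym (shift-0∷ a α _))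
    (cancelˡ A _ _ (subst N (shift-fund a α g w) (K (a ∷ α) (g ∷ w) g0 z≤n (≤-trans (m≤n+m _ 2) le)))
                   (all-gaps (suc a ∷ α) w g (weaken g le)))
    where
    weaken : ∀ g → 2 + suc h ≤ slack g + weight w → gap g + suc h ≤ weight w
    weaken g0 (s≤s (s≤s q)) = q
    weaken g1 (s≤s q) = q
    weaken g2 q = q

  module _ (e : ℕ) (below : ∀ e' → e' < e → ∀ v → N ((e' ∷ v) ∷ [])) where

    -- Of the two terms of the recursion, the one with first exponent b lies in N by `below`, hence
    -- so does the other.
    raise : ∀ b (α : Vec ℕ m) g w → b < e → N (map ((b ∷ α) +ᵥ_) (fund (g ∷ w) 0 (suc m))) →
            N (map ((suc b ∷ α) +ᵥ_) (fund w (gap g) (suc m)))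
    raise b α g w b<e x = cancelʳ A _ _ (subst N (shift-fund b α g w) x)
                                        (all (prefixed b A) _ (below b b<e))

    raises : ∀ k b (α : Vec ℕ m) w → k + b ≤ e →
             N (map ((b ∷ α) +ᵥ_) (fund (replicate k g0 ++ w) 0 (suc m))) →
             N (map ((k + b ∷ α) +ᵥ_) (fund w 0 (suc m)))
    raises zero    b α w le x = x
    raises (suc k) b α w le x = subst (λ c → N (map ((c ∷ α) +ᵥ_) (fund w 0 (suc m)))) (+-suc k b)
      (raises k (suc b) α w (subst (_≤ e) (sym (+-suc k b)) le)
        (raise b α g0 _ (≤-trans (s≤s (m≤n+m b k)) le) x))

    -- Put k letters with gap 0 in front of w, which adds 2k to the weight, and trade them one by
    -- one for factors of the first variable.
    from-zero : ∀ k (α : Vec ℕ m) w → k ≤ e → suc h ≤ k * 2 + weight w →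
                N (map ((k ∷ α) +ᵥ_) (fund w 0 (suc m)))
    from-zero k α w k≤e le = subst (λ c → N (map ((c ∷ α) +ᵥ_) (fund w 0 (suc m)))) (+-identityʳ k)
      (raises k 0 α w (subst (_≤ e) (sym (+-identityʳ k)) k≤e)
        (K (0 ∷ α) (replicate k g0 ++ w) g0 z≤n (subst (suc h ≤_) (sym (weight-g0 k w)) le)))

    -- Apply `from-zero` to the empty word, whose polynomial is 1; the e letters in front already
    -- have weight 2e > h.
    non-Dyck : h < e * 2 → ∀ α → N ((e ∷ α) ∷ [])
    non-Dyck h<2e α = subst (λ v → N (v ∷ [])) (zipWith-identityʳ +-identityʳ (e ∷ α))
      (from-zero e α [] ≤-refl (≤-trans h<2e (m≤m+n _ 0)))

  -- A delay of 0 or 1 behind the first position is a delay of 1 or 2 at it. For e = 0 this is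
  -- `all-gaps`; otherwise the last of e letters in front of w gets the gap `g1` or `g2` and is
  -- traded by `raise`.
  tail-contains : ∀ e k → h ≡ e * 2 + k → (∀ e' → e' < e → ∀ v → N ((e' ∷ v) ∷ [])) →
                  ContainsFund (suc (suc k)) (N ∘ map (e ∷_))
  tail-contains e k eq below α w g g≤1 le =
    subst N (trans (cong (map ((e ∷ α) +ᵥ_)) (fund-suc w (gap g) m)) (shift-0∷ e α _)) (go e g eq below g≤1 le)
    where
    go : ∀ e g → h ≡ e * 2 + k → (∀ e' → e' < e → ∀ v → N ((e' ∷ v) ∷ [])) → gap g ≤ 1 →
         gap g + suc (suc k) ≤ weight w → N (map ((e ∷ α) +ᵥ_) (fund w (suc (gap g)) (suc m)))
    go zero g0 refl below _ le = all-gaps (0 ∷ α) w g1 le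
    go zero g1 refl below _ le = all-gaps (0 ∷ α) w g2 le
    go (suc e) g0 refl below _ le = raise (suc e) below e α g1 w ≤-refl
      (from-zero (suc e) below e α (g1 ∷ w) (n≤1+n e) (subst (_≤ e * 2 + (1 + weight w)) (lem e k)
        (+-monoʳ-≤ (e * 2) (s≤s le))))
      where lem : ∀ e k → e * 2 + (1 + suc (suc k)) ≡ suc (2 + e * 2 + k)
            lem = solve-∀
    go (suc e) g1 refl below _ le = raise (suc e) below e α g2 w ≤-refl
      (from-zero (suc e) below e α (g2 ∷ w) (n≤1+n e) (subst (_≤ e * 2 + (0 + weight w)) (lem e k)
        (+-monoʳ-≤ (e * 2) le)))
      where lem : ∀ e k → e * 2 + (suc (suc (suc k))) ≡ suc (2 + e * 2 + k)
            lem = solve-∀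
    go _ g2 eq below (s≤s ()) le

-- Induction on m and strong induction on the first exponent e. If 2e > h, the monomial reduces to
-- smaller first exponents; otherwise e is fixed and the tail is reduced from height h - 2e + 1.
reduce : ∀ m h (N : List (Vec ℕ m) → Set) → Additive N → ContainsFund (suc h) N →
         (∀ v → Dyck h v → N (v ∷ [])) → ∀ v → N (v ∷ [])
reduce zero    h N A K D [] = D [] _
reduce (suc m) h N A K D (e ∷ v) = <-rec (λ e → ∀ v → N ((e ∷ v) ∷ [])) step e v
  where
  open Peel h N A K
  step : ∀ e → (∀ {e'} → e' < e → ∀ v → N ((e' ∷ v) ∷ [])) → ∀ v → N ((e ∷ v) ∷ [])
  step e below with e * 2 ≤? h
  ... | no  2e≰h = non-Dyck e (λ _ → below) (≰⇒> 2e≰h)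
  ... | yes 2e≤h = reduce m (suc (h ∸ e * 2)) (N ∘ map (e ∷_)) (prefixed e A)
    (tail-contains e (h ∸ e * 2) (sym (m+[n∸m]≡n 2e≤h)) (λ _ → below))
    (λ v d → D (e ∷ v) (subst (λ k → Dyck k (e ∷ v)) (m+[n∸m]≡n 2e≤h) (Dyck-cons e (h ∸ e * 2) v d)))

-- Independence

Coeffs : ℕ → Set
Coeffs m = Vec ℕ m → ℚ

infix 4 _≐_
_≐_ : ∀ {m} → Coeffs m → Coeffs m → Set
f ≐ g = ∀ v → f v ≡ g v

zeros : ∀ {m} → Vec ℕ m
zeros = Vec.replicate _ 0

times : ∀ {m} → Vec ℕ m → Coeffs m → Coeffs m
times []          s []          = s []
times (zero ∷ α)  s (b ∷ v)     = times α (s ∘ (b ∷_)) v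
times (suc a ∷ α) s (zero ∷ v)  = 0ℚ
times (suc a ∷ α) s (suc b ∷ v) = times (a ∷ α) s (b ∷ v)

times-cong : ∀ {m} (α : Vec ℕ m) {s s'} → s ≐ s' → times α s ≐ times α s'
times-cong []          e []          = e []
times-cong (zero ∷ α)  e (b ∷ v)     = times-cong α (λ u → e (b ∷ u)) v
times-cong (suc a ∷ α) e (zero ∷ v)  = refl
times-cong (suc a ∷ α) e (suc b ∷ v) = times-cong (a ∷ α) e (b ∷ v)

-- The operator of the independence argument, read on coefficients: substituting 0 selects the
-- exponents that are 0 there, and dividing by z_i turns the exponent `suc a` into `a`.
trim : ∀ {m} → Fin m → Coeffs (2 + m) → Coeffs m
trim zero    f (a ∷ v) = f (suc a ∷ 0 ∷ 0 ∷ v) ℚ.- f (0 ∷ 0 ∷ suc a ∷ v)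
trim (suc i) f (b ∷ v) = trim i (f ∘ (b ∷_)) v

trim-0 : ∀ {m} (i : Fin m) → trim i (λ _ → 0ℚ) ≐ (λ _ → 0ℚ)
trim-0 zero    (a ∷ v) = refl
trim-0 (suc i) (b ∷ v) = trim-0 i v

Symmetric : ∀ {m} → Fin m → Coeffs (2 + m) → Set
Symmetric zero    s = ∀ a v → s (suc a ∷ 0 ∷ 0 ∷ v) ≡ s (0 ∷ 0 ∷ suc a ∷ v)
Symmetric (suc i) s = ∀ b → Symmetric i (s ∘ (b ∷_))

insert : ∀ {m} → Fin m → Vec ℕ m → Vec ℕ (2 + m)
insert zero    v       = 0 ∷ 0 ∷ v
insert (suc i) (b ∷ v) = b ∷ insert i v

-- The twisted Leibniz rule trim i (f s) = trim i f · (s ∘ insert i) for a monomial f and a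
-- quasisymmetric s.
trim-times : ∀ {m} (i : Fin m) (α : Vec ℕ (2 + m)) → ∃ λ (c : ℚ) → ∃ λ (β : Vec ℕ m) →
  ∀ s → Symmetric i s → ∀ v → trim i (times α s) v ≡ c ℚ.* times β (s ∘ insert i) v
trim-times zero (zero ∷ zero ∷ zero ∷ α) = 0ℚ , zero ∷ α , λ { s σ (a ∷ v) →
  trans (cong (ℚ._- times α (λ u → s (0 ∷ 0 ∷ suc a ∷ u)) v) (times-cong α (σ a) v))
    (trans (ℚ.+-inverseʳ (times α (λ u → s (0 ∷ 0 ∷ suc a ∷ u)) v))
           (sym (ℚ.*-zeroˡ (times α (λ u → s (0 ∷ 0 ∷ a ∷ u)) v)))) }
-- The substitution (0, 0, z_i) kills this monomial. In the other one, symmetry turns s(z_i, 0, 0)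
-- into s(0, 0, z_i).
trim-times zero (suc k ∷ zero ∷ zero ∷ α) = 1ℚ , k ∷ α , λ { s σ (a ∷ v) →
  trans (ℚ.+-identityʳ _) (trans (trans (slide k a v s)
    (times-cong (k ∷ α) (λ { (zero ∷ u) → refl ; (suc b ∷ u) → σ b u }) (a ∷ v))) (sym (ℚ.*-identityˡ _))) }
  where
  slide : ∀ k a v s → times (k ∷ 0 ∷ 0 ∷ α) s (a ∷ 0 ∷ 0 ∷ v) ≡
          times (k ∷ α) (λ u → s (Vec.head u ∷ 0 ∷ 0 ∷ Vec.tail u)) (a ∷ v)
  slide zero    a       v s = refl
  slide (suc k) zero    v s = refl
  slide (suc k) (suc a) v s = slide k a v s
trim-times zero (zero ∷ zero ∷ suc k ∷ α) = ℚ.- 1ℚ , k ∷ α , λ { s σ (a ∷ v) →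
  trans (ℚ.+-identityˡ (ℚ.- times (k ∷ α) (λ u → s (0 ∷ 0 ∷ u)) (a ∷ v)))
        (trans (cong ℚ.-_ (sym (ℚ.*-identityˡ _)))
               (ℚ.neg-distribˡ-* 1ℚ (times (k ∷ α) (λ u → s (0 ∷ 0 ∷ u)) (a ∷ v)))) }
trim-times zero (zero ∷ suc l ∷ k ∷ α) = 0ℚ , k ∷ α , λ { s σ (a ∷ v) →
  sym (ℚ.*-zeroˡ (times (k ∷ α) (s ∘ insert zero) (a ∷ v))) }
trim-times zero (suc j ∷ suc l ∷ k ∷ α) = 0ℚ , k ∷ α , λ { s σ (a ∷ v) →
  trans (cong (ℚ._- 0ℚ) (vanish j a v s)) (sym (ℚ.*-zeroˡ (times (k ∷ α) (s ∘ insert zero) (a ∷ v)))) }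
  where
  vanish : ∀ j a v s → times (j ∷ suc l ∷ k ∷ α) s (a ∷ 0 ∷ 0 ∷ v) ≡ 0ℚ
  vanish zero    a       v s = refl
  vanish (suc j) zero    v s = refl
  vanish (suc j) (suc a) v s = vanish j a v s
trim-times zero (suc j ∷ zero ∷ suc k ∷ α) = 0ℚ , k ∷ α , λ { s σ (a ∷ v) →
  trans (cong (ℚ._- 0ℚ) (vanish j a v s)) (sym (ℚ.*-zeroˡ (times (k ∷ α) (s ∘ insert zero) (a ∷ v)))) }
  where
  vanish : ∀ j a v s → times (j ∷ 0 ∷ suc k ∷ α) s (a ∷ 0 ∷ 0 ∷ v) ≡ 0ℚ
  vanish zero    a       v s = refl
  vanish (suc j) zero    v s = refl
  vanish (suc j) (suc a) v s = vanish j a v s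
trim-times (suc i) (e ∷ α) with trim-times i α
... | c , β , eq = c , e ∷ β , λ { s σ (b ∷ v) → go e s σ b v }
  where
  go : ∀ e s → Symmetric (suc i) s → ∀ b v → trim i (λ u → times (e ∷ α) s (b ∷ u)) v ≡
       c ℚ.* times (e ∷ β) (s ∘ insert (suc i)) (b ∷ v)
  go zero    s σ b       v = eq (s ∘ (b ∷_)) (σ b) v
  go (suc e) s σ zero    v = trans (trim-0 i v) (sym (ℚ.*-zeroʳ c))
  go (suc e) s σ (suc b) v = go e s σ b v

QSym : ∀ {m} → Coeffs (2 + m) → Set
QSym s = ∀ i → Symmetric i s

restrict : ∀ {m} → Coeffs (2 + m) → Coeffs m
restrict s v = s (0 ∷ 0 ∷ v)

-- Quasisymmetry moves the two inserted zeros to the front, past one exponent at a time. Hence the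
-- second factor of the Leibniz rule does not depend on i.
insert-QSym : ∀ {m} (s : Coeffs (2 + m)) → QSym s → (i : Fin m) → s ∘ insert i ≐ restrict s
insert-QSym s σ zero    v = refl
insert-QSym s σ (suc i) (b ∷ v) = trans (insert-QSym (s ∘ (b ∷_)) (λ j → σ (suc j) b) i v) (swap b)
  where
  swap : ∀ b → s (b ∷ 0 ∷ 0 ∷ v) ≡ s (0 ∷ 0 ∷ b ∷ v)
  swap zero    = refl
  swap (suc b) = σ zero b v

Quasi : ∀ n → Coeffs (n * 2) → Set
Quasi zero    s = ⊤
Quasi (suc n) s = QSym s

restrict-Quasi : ∀ n s → Quasi (suc n) s → Quasi n (restrict s)
restrict-Quasi zero    s σ = tt
restrict-Quasi (suc n) s σ i = σ (suc (suc i)) 0 0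

-- The ideal built from one multiple c z^α s at a time, so that the Leibniz rule for monomials
-- applies to each summand.
data Ideal (n : ℕ) : Coeffs (n * 2) → Set where
  none  : ∀ {f} → f ≐ (λ _ → 0ℚ) → Ideal n f
  plus : ∀ {f} c α s g → Quasi n s → s zeros ≡ 0ℚ → Ideal n g →
         (∀ v → f v ≡ c ℚ.* times α s v ℚ.+ g v) → Ideal n f

trim-cong : ∀ {m} (i : Fin m) {f g} → f ≐ g → trim i f ≐ trim i g
trim-cong zero    e (a ∷ v) = cong₂ ℚ._-_ (e _) (e _)
trim-cong (suc i) e (b ∷ v) = trim-cong i (λ u → e (b ∷ u)) v

trim-linear : ∀ {m} (i : Fin m) c f g →
  trim i (λ v → c ℚ.* f v ℚ.+ g v) ≐ (λ v → c ℚ.* trim i f v ℚ.+ trim i g v)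
trim-linear zero    c f g (a ∷ v) = solve 5 (λ c x y x' y' →
    (c :* x :+ y) :- (c :* x' :+ y') := c :* (x :- x') :+ (y :- y')) refl
    c (f (suc a ∷ 0 ∷ 0 ∷ v)) (g (suc a ∷ 0 ∷ 0 ∷ v)) (f (0 ∷ 0 ∷ suc a ∷ v)) (g (0 ∷ 0 ∷ suc a ∷ v))
trim-linear (suc i) c f g (b ∷ v) = trim-linear i c (f ∘ (b ∷_)) (g ∘ (b ∷_)) v

trim-Ideal : ∀ n {f} (i : Fin (n * 2)) → Ideal (suc n) f → Ideal n (trim i f)
trim-Ideal n i (none e) = none (λ v → trans (trim-cong i e v) (trim-0 i v))
trim-Ideal n i (plus c α s g σ s0 I e) with trim-times i α
... | c' , β , eq = plus (c ℚ.* c') β (restrict s) (trim i g) (restrict-Quasi n s σ) s0 (trim-Ideal n i I)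
  (λ v → trans (trim-cong i e v) (trans (trim-linear i c (times α s) g v)
    (cong (ℚ._+ trim i g v) (trans (cong (c ℚ.*_) (trans (eq s (σ i) v)
      (cong (c' ℚ.*_) (times-cong β (insert-QSym s σ i) v))))
      (sym (ℚ.*-assoc c c' (times β (restrict s) v)))))))

times-constant : ∀ {m} (α : Vec ℕ m) s → s zeros ≡ 0ℚ → times α s zeros ≡ 0ℚ
times-constant []          s s0 = s0
times-constant (zero ∷ α)  s s0 = times-constant α (s ∘ (0 ∷_)) s0
times-constant (suc a ∷ α) s s0 = refl

Ideal-constant : ∀ n {f} → Ideal n f → f zeros ≡ 0ℚ
Ideal-constant n (none e) = e zeros
Ideal-constant n (plus c α s g σ s0 I e) = trans (e zeros)
  (cong₂ ℚ._+_ (trans (cong (c ℚ.*_) (times-constant α s s0)) (ℚ.*-zeroʳ c)) (Ideal-constant n I))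

DyckSupported : ∀ {m} → ℕ → Coeffs m → Set
DyckSupported h f = ∀ v → ¬ Dyck h v → f v ≡ 0ℚ

-- Both vectors compared by `trim` have one more unit, which costs height 2, and two more zeros,
-- which regain it. If either is Dyck, so is the vector it is compared for.
trim-supported : ∀ {m} h (i : Fin m) f → DyckSupported h f → DyckSupported h (trim i f)
trim-supported h i f D v ¬d = go h i f D v ¬d
  where
  up : ∀ {m} h a (v : Vec ℕ m) → Dyck h (a ∷ 0 ∷ 0 ∷ v) → Dyck (2 + h) (a ∷ v)
  up h             zero    v d = d
  up (suc (suc h)) (suc a) v d = up h a v d
  up′ : ∀ {m} h a (v : Vec ℕ m) → Dyck h (suc a ∷ 0 ∷ 0 ∷ v) → Dyck h (a ∷ v)
  up′ (suc (suc h)) a v d = up h a v d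
  go : ∀ {m} h (i : Fin m) f → DyckSupported h f → ∀ v → ¬ Dyck h v → trim i f v ≡ 0ℚ
  go h zero f D (a ∷ v) ¬d rewrite D (suc a ∷ 0 ∷ 0 ∷ v) (¬d ∘ up′ h a v) | D (0 ∷ 0 ∷ suc a ∷ v) ¬d = refl
  go h (suc i) f D (zero ∷ v) ¬d = go (suc h) i (f ∘ (0 ∷_)) (λ u → D (0 ∷ u)) v ¬d
  go zero (suc i) f D (suc b ∷ v) ¬d =
    trans (trim-cong i (λ u → D (suc b ∷ u) (λ ())) v) (trim-0 i v)
  go (suc zero) (suc i) f D (suc b ∷ v) ¬d =
    trans (trim-cong i (λ u → D (suc b ∷ u) (λ ())) v) (trim-0 i v)
  go (suc (suc h)) (suc i) f D (suc b ∷ v) ¬d =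
    go h (suc i) (λ { (b ∷ u) → f (suc b ∷ u) }) (λ { (b ∷ u) ¬d → D (suc b ∷ u) ¬d }) (b ∷ v) ¬d

Symmetric-trim : ∀ {m} (i : Fin m) f → trim i f ≐ (λ _ → 0ℚ) → Symmetric i f
Symmetric-trim zero    f e a v = x∙y⁻¹≈ε⇒x≈y ℚ.+-0-group _ _ (e (a ∷ v))
Symmetric-trim (suc i) f e b = Symmetric-trim i (f ∘ (b ∷_)) (λ v → e (b ∷ v))

-- Quasisymmetry moves the first nonzero exponent to one of the first two positions.
QSym-vanishes : ∀ m (f : Coeffs (2 + m)) → QSym f → (∀ a v → f (suc a ∷ v) ≡ 0ℚ) →
  (∀ a v → f (0 ∷ suc a ∷ v) ≡ 0ℚ) → f zeros ≡ 0ℚ → f ≐ (λ _ → 0ℚ)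
QSym-vanishes m       f σ p q z (suc a ∷ v)            = p a v
QSym-vanishes m       f σ p q z (zero ∷ suc a ∷ v)     = q a v
QSym-vanishes zero    f σ p q z (zero ∷ zero ∷ [])     = z
QSym-vanishes (suc m) f σ p q z (zero ∷ zero ∷ v)      =
  QSym-vanishes m (f ∘ (0 ∷_)) (λ i → σ (suc i) 0) q (λ a u → trans (sym (σ zero a u)) (p a _)) z (zero ∷ v)

Ideal-Dyck : ∀ n f → Ideal n f → DyckSupported 0 f → f ≐ (λ _ → 0ℚ)
Ideal-Dyck zero    f I D []  = Ideal-constant 0 I
Ideal-Dyck (suc n) f I D     = QSym-vanishes (n * 2) f
  (λ i → Symmetric-trim i f (Ideal-Dyck n (trim i f) (trim-Ideal n i I) (trim-supported 0 i f D)))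
  -- The first two positions have heights 0 and 1, too low for a positive exponent.
  (λ a v → D (suc a ∷ v) (λ ())) (λ a v → D (0 ∷ suc a ∷ v) (λ ())) (Ideal-constant (suc n) I)

-- Fundamental polynomials as gap words

δ : ∀ {m} → Vec ℕ m → Coeffs m
δ []      []      = 1ℚ
δ (a ∷ α) (b ∷ v) = if a ≡ᵇ b then δ α v else 0ℚ

multiplicity : ∀ {m} → List (Vec ℕ m) → Coeffs m
multiplicity []      v = 0ℚ
multiplicity (α ∷ p) v = δ α v ℚ.+ multiplicity p v

multiplicity-++ : ∀ {m} (p q : List (Vec ℕ m)) v →
  multiplicity (p ++ q) v ≡ multiplicity p v ℚ.+ multiplicity q v
multiplicity-++ []      q v = sym (ℚ.+-identityˡ _)
multiplicity-++ (α ∷ p) q v = trans (cong (δ α v ℚ.+_) (multiplicity-++ p q v)) (sym (ℚ.+-assoc (δ α v) _ _))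

multiplicity-0∷-0 : ∀ {m} (p : List (Vec ℕ m)) v → multiplicity (map (0 ∷_) p) (0 ∷ v) ≡ multiplicity p v
multiplicity-0∷-0 []      v = refl
multiplicity-0∷-0 (α ∷ p) v = cong (δ α v ℚ.+_) (multiplicity-0∷-0 p v)

multiplicity-0∷-suc : ∀ {m} (p : List (Vec ℕ m)) b v → multiplicity (map (0 ∷_) p) (suc b ∷ v) ≡ 0ℚ
multiplicity-0∷-suc []      b v = refl
multiplicity-0∷-suc (α ∷ p) b v = trans (ℚ.+-identityˡ _) (multiplicity-0∷-suc p b v)

multiplicity-bump-0 : ∀ {m} (p : List (Vec ℕ (suc m))) v → multiplicity (map bump p) (0 ∷ v) ≡ 0ℚ
multiplicity-bump-0 []            v = refl
multiplicity-bump-0 ((a ∷ α) ∷ p) v = trans (ℚ.+-identityˡ _) (multiplicity-bump-0 p v)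

multiplicity-bump-suc : ∀ {m} (p : List (Vec ℕ (suc m))) b v →
  multiplicity (map bump p) (suc b ∷ v) ≡ multiplicity p (b ∷ v)
multiplicity-bump-suc []            b v = refl
multiplicity-bump-suc ((a ∷ α) ∷ p) b v = cong (δ (a ∷ α) (b ∷ v) ℚ.+_) (multiplicity-bump-suc p b v)

fundCoeff : List Gap → ℕ → ∀ {m} → Coeffs m
fundCoeff w d v = multiplicity (fund w d _) v

fundCoeff-place : ∀ {m} g w a (v : Vec ℕ m) → fundCoeff (g ∷ w) 0 (suc a ∷ v) ≡ fundCoeff w (gap g) (a ∷ v)
fundCoeff-place g w a v = trans (multiplicity-++ (map bump (fund w (gap g) _)) _ (suc a ∷ v))
  (trans (cong₂ ℚ._+_ (multiplicity-bump-suc (fund w (gap g) _) a v)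
                       (multiplicity-0∷-suc (fund (g ∷ w) 1 _) a v))
         (ℚ.+-identityʳ _))

fundCoeff-skip : ∀ {m} w (v : Vec ℕ m) → fundCoeff w 0 (0 ∷ v) ≡ fundCoeff w 1 v
fundCoeff-skip []      v = refl
fundCoeff-skip (g ∷ w) v = trans (multiplicity-++ (map bump (fund w (gap g) _)) _ (0 ∷ v))
  (trans (cong₂ ℚ._+_ (multiplicity-bump-0 (fund w (gap g) _) v)
                       (multiplicity-0∷-0 (fund (g ∷ w) 1 _) v))
         (ℚ.+-identityˡ _))

fundCoeff-wait : ∀ {m} w d (v : Vec ℕ m) → fundCoeff w (suc d) (0 ∷ v) ≡ fundCoeff w d v
fundCoeff-wait w d v = trans (cong (λ p → multiplicity p (0 ∷ v)) (fund-suc w d _))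
                             (multiplicity-0∷-0 (fund w d _) v)

fundCoeff-early : ∀ {m} w d a (v : Vec ℕ m) → fundCoeff w (suc d) (suc a ∷ v) ≡ 0ℚ
fundCoeff-early w d a v = trans (cong (λ p → multiplicity p (suc a ∷ v)) (fund-suc w d _))
                                (multiplicity-0∷-suc (fund w d _) a v)

fundCoeff-period₀ : ∀ {m} w (v : Vec ℕ m) → fundCoeff w 0 (0 ∷ 0 ∷ v) ≡ fundCoeff w 0 v
fundCoeff-period₀ w v = trans (fundCoeff-skip w (0 ∷ v)) (fundCoeff-wait w 0 v)

fundCoeff-period₁ : ∀ {m} w (v : Vec ℕ m) → fundCoeff w 1 (0 ∷ 0 ∷ v) ≡ fundCoeff w 1 v
fundCoeff-period₁ w v = trans (fundCoeff-wait w 0 (0 ∷ v)) (fundCoeff-skip w v)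

-- Letters are placed until the exponent a is used up or a positive delay rules it out. The two
-- zeros then only advance the pending word by a full period.
fundCoeff-stretch : ∀ {m} w g a (v : Vec ℕ m) →
  fundCoeff w (gap g) (a ∷ 0 ∷ 0 ∷ v) ≡ fundCoeff w (gap g) (a ∷ v)
fundCoeff-stretch w g0 zero v = trans (fundCoeff-skip w (0 ∷ 0 ∷ v))
  (trans (fundCoeff-period₁ w v) (sym (fundCoeff-skip w v)))
fundCoeff-stretch w g1 zero v = trans (fundCoeff-wait w 0 (0 ∷ 0 ∷ v))
  (trans (fundCoeff-period₀ w v) (sym (fundCoeff-wait w 0 v)))
fundCoeff-stretch w g2 zero v = trans (fundCoeff-wait w 1 (0 ∷ 0 ∷ v))
  (trans (fundCoeff-period₁ w v) (sym (fundCoeff-wait w 1 v)))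
fundCoeff-stretch []      g0 (suc a) v = refl
fundCoeff-stretch (g ∷ w) g0 (suc a) v = trans (fundCoeff-place g w a (0 ∷ 0 ∷ v))
  (trans (fundCoeff-stretch w g a v) (sym (fundCoeff-place g w a v)))
fundCoeff-stretch w g1 (suc a) v = trans (fundCoeff-early w 0 a (0 ∷ 0 ∷ v)) (sym (fundCoeff-early w 0 a v))
fundCoeff-stretch w g2 (suc a) v = trans (fundCoeff-early w 1 a (0 ∷ 0 ∷ v)) (sym (fundCoeff-early w 1 a v))

Symmetric-cong : ∀ {m} (i : Fin m) {f g} → f ≐ g → Symmetric i g → Symmetric i f
Symmetric-cong zero    e σ a v = trans (e _) (trans (σ a v) (sym (e _)))
Symmetric-cong (suc i) e σ b   = Symmetric-cong i (λ v → e (b ∷ v)) (σ b)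

Symmetric-0 : ∀ {m} (i : Fin m) → Symmetric i (λ _ → 0ℚ)
Symmetric-0 zero    a v = refl
Symmetric-0 (suc i) b   = Symmetric-0 i

Symmetric-linear : ∀ {m} (i : Fin m) c {f g} → Symmetric i f → Symmetric i g →
  Symmetric i (λ v → c ℚ.* f v ℚ.+ g v)
Symmetric-linear zero    c σ τ a v = cong₂ (λ x y → c ℚ.* x ℚ.+ y) (σ a v) (τ a v)
Symmetric-linear (suc i) c σ τ b   = Symmetric-linear i c (σ b) (τ b)

offset : Letter → ℕ
offset X = 0
offset Y = 1

-- At the front, `fundCoeff-stretch` deletes the zeros behind the exponent and periodicity those
-- before it. For a later pattern, `inner` first consumes the exponents in front, letter by letter.
fundCoeff-QSym : ∀ {m} l w → QSym {m} (fundCoeff w (offset l))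
fundCoeff-QSym l w i = at i w l
  where
  at   : ∀ {m} (i : Fin m) w l → Symmetric i (fundCoeff w (offset l))
  inner : ∀ {m} (i : Fin m) w g b → Symmetric i (λ v → fundCoeff w (gap g) (b ∷ v))
  at zero    w X a v = trans (fundCoeff-stretch w g0 (suc a) v) (sym (fundCoeff-period₀ w (suc a ∷ v)))
  at zero    w Y a v = trans (fundCoeff-stretch w g1 (suc a) v) (sym (fundCoeff-period₁ w (suc a ∷ v)))
  at (suc i) w X b   = inner i w g0 b
  at (suc i) w Y b   = inner i w g1 b
  inner i w       g0 zero    = Symmetric-cong i (fundCoeff-skip w) (at i w Y)
  inner i w       g1 zero    = Symmetric-cong i (fundCoeff-wait w 0) (at i w X)
  inner i w       g2 zero    = Symmetric-cong i (fundCoeff-wait w 1) (at i w Y)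
  inner i []      g0 (suc b) = Symmetric-0 i
  inner i (g ∷ w) g0 (suc b) = Symmetric-cong i (fundCoeff-place g w b) (inner i w g b)
  inner i w       g1 (suc b) = Symmetric-cong i (fundCoeff-early w 0 b) (Symmetric-0 i)
  inner i w       g2 (suc b) = Symmetric-cong i (fundCoeff-early w 1 b) (Symmetric-0 i)

fundCoeff-constant : ∀ m g w d → fundCoeff (g ∷ w) d {m} zeros ≡ 0ℚ
fundCoeff-constant zero    g w d       = refl
fundCoeff-constant (suc m) g w zero    = trans (fundCoeff-skip {m} (g ∷ w) zeros) (fundCoeff-constant m g w 1)
fundCoeff-constant (suc m) g w (suc d) = trans (fundCoeff-wait {m} (g ∷ w) d zeros) (fundCoeff-constant m g w d)

-- Interleaving the exponents of x and y, and the enumeration of F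

unzip : ∀ n → Vec ℕ (n * 2) → Mono n
unzip zero    []          = [] , []
unzip (suc n) (a ∷ b ∷ v) = a ∷ proj₁ (unzip n v) , b ∷ proj₂ (unzip n v)

zip : ∀ n → Mono n → Vec ℕ (n * 2)
zip zero    m                   = []
zip (suc n) (a ∷ xs , b ∷ ys) = a ∷ b ∷ zip n (xs , ys)

zip-unzip : ∀ n v → zip n (unzip n v) ≡ v
zip-unzip zero    []          = refl
zip-unzip (suc n) (a ∷ b ∷ v) = cong (λ u → a ∷ b ∷ u) (zip-unzip n v)

unzip-zip : ∀ n m → unzip n (zip n m) ≡ m
unzip-zip zero    ([] , [])             = refl
unzip-zip (suc n) (a ∷ xs , b ∷ ys) = cong (λ m → a ∷ proj₁ m , b ∷ proj₂ m) (unzip-zip n (xs , ys))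

unzip-zeros : ∀ n → unzip n zeros ≡ one-mono
unzip-zeros zero    = refl
unzip-zeros (suc n) = cong (λ m → 0 ∷ proj₁ m , 0 ∷ proj₂ m) (unzip-zeros n)

unzip-+ : ∀ n α β → unzip n (α +ᵥ β) ≡ mono-mul (unzip n α) (unzip n β)
unzip-+ zero    []          []          = refl
unzip-+ (suc n) (a ∷ b ∷ α) (c ∷ d ∷ β) =
  cong (λ m → a + c ∷ proj₁ m , b + d ∷ proj₂ m) (unzip-+ n α β)

zip-mul : ∀ n m m' → zip n (mono-mul m m') ≡ zip n m +ᵥ zip n m'
zip-mul zero    m m' = refl
zip-mul (suc n) (a ∷ xs , b ∷ ys) (a' ∷ xs' , b' ∷ ys') =
  cong (λ v → a + a' ∷ b + b' ∷ v) (zip-mul n (xs , ys) (xs' , ys'))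

cons0 : ∀ {n} → Mono n → Mono (suc n)
cons0 (xs , ys) = 0 ∷ xs , 0 ∷ ys

enum-shift : ∀ n w lo → enum (suc n) w (suc lo) ≡ map cons0 (enum n w lo)
enum-shift n []            lo = refl
enum-shift n ((l , s) ∷ w) lo = trans (cong (concatMap _) (map-∘ (upTo (n ∸ lo)))) (go (range lo n))
  where
  incL-cons0 : ∀ l m → (λ x → incL l (suc m) (cons0 x)) ≗ (λ x → cons0 {n} (incL l m x))
  incL-cons0 X m x = refl
  incL-cons0 Y m x = refl
  term : ∀ s m → map (incL l (suc m)) (enum (suc n) w (if s then suc (suc m) else suc m)) ≡
               map cons0 (map (incL l m) (enum n w (if s then suc m else m)))
  term true  m = trans (cong (map _) (enum-shift n w (suc m))) (trans (sym (map-∘ (enum n w (suc m))))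
    (trans (map-cong (incL-cons0 l m) _) (map-∘ (enum n w (suc m)))))
  term false m = trans (cong (map _) (enum-shift n w m)) (trans (sym (map-∘ (enum n w m)))
    (trans (map-cong (incL-cons0 l m) _) (map-∘ (enum n w m))))
  go : ∀ ms → concatMap (λ m → map (incL l m) (enum (suc n) w (if s then suc m else m))) (map suc ms) ≡
              map cons0 (concatMap (λ m → map (incL l m) (enum n w (if s then suc m else m))) ms)
  go []       = refl
  go (m ∷ ms) = trans (cong₂ _++_ (term s m) (go ms))
    (sym (map-++ cons0 (map (incL l m) (enum n w (if s then suc m else m))) _))

enum-suc : ∀ n l s w → enum (suc n) ((l , s) ∷ w) 0 ≡
  map (incL l 0) (enum (suc n) w (if s then 1 else 0)) ++ map cons0 (enum n ((l , s) ∷ w) 0)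
enum-suc n l s w = cong (map (incL l 0) (enum (suc n) w (if s then 1 else 0)) ++_)
  (trans (cong (concatMap _) (trans (map-applyUpTo suc id n) (sym (map-applyUpTo id suc n))))
         (enum-shift n ((l , s) ∷ w) 0))

-- A gap word with its first letter determines the remaining letters: passing from position i to
-- j ≥ i + gap g in x₁ , y₁ , x₂ , y₂ , … with the parity of j fixed is either a weak or a strict
-- increase of the index. The gap after the last letter is irrelevant.
next : Letter → Gap → Letter
next X g0 = X
next X g1 = Y
next X g2 = X
next Y g0 = Y
next Y g1 = X
next Y g2 = Y

strict : Letter → Gap → List Gap → Bool
strict l g  []      = true
strict l g0 (_ ∷ _) = false
strict X g1 (_ ∷ _) = false
strict Y g1 (_ ∷ _) = true
strict l g2 (_ ∷ _) = true

letters : Letter → List Gap → List (Letter × Bool)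
letters l []      = []
letters l (g ∷ w) = (l , strict l g w) ∷ letters (next l g) w

map-unzip-0∷0∷ : ∀ n p → map (unzip (suc n)) (map (0 ∷_) (map (0 ∷_) p)) ≡ map cons0 (map (unzip n) p)
map-unzip-0∷0∷ n []      = refl
map-unzip-0∷0∷ n (v ∷ p) = cong (_ ∷_) (map-unzip-0∷0∷ n p)

map-unzip-bump : ∀ n p → map (unzip (suc n)) (map bump p) ≡ map (incL X 0) (map (unzip (suc n)) p)
map-unzip-bump n []                = refl
map-unzip-bump n ((a ∷ b ∷ v) ∷ p) = cong (_ ∷_) (map-unzip-bump n p)

map-unzip-0∷bump : ∀ n p → map (unzip (suc n)) (map (0 ∷_) (map bump p)) ≡
                           map (incL Y 0) (map (unzip (suc n)) (map (0 ∷_) p))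
map-unzip-0∷bump n []            = refl
map-unzip-0∷bump n ((b ∷ v) ∷ p) = cong (_ ∷_) (map-unzip-0∷bump n p)

-- Both sides list the same monomials in the same order: first those whose first letter sits in the
-- pair x₁ , y₁, then those avoiding that pair.
enum-fund : ∀ n l w → map (unzip n) (fund w (offset l) (n * 2)) ≡ enum n (letters l w) 0
enum-fund n       l []      = cong (_∷ []) (unzip-zeros n)
enum-fund zero    X (g ∷ w) = refl
enum-fund zero    Y (g ∷ w) = refl
enum-fund (suc n) X (g ∷ w) = trans (map-++ (unzip (suc n)) (map bump (fund w (gap g) _)) _)
  (trans (cong₂ _++_ (trans (map-unzip-bump n (fund w (gap g) _)) (cong (map (incL X 0)) (first g w)))
                     (trans (map-unzip-0∷0∷ n (fund (g ∷ w) 0 (n * 2))) (cong (map cons0) (enum-fund n X (g ∷ w)))))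
         (sym (enum-suc n X (strict X g w) (letters (next X g) w))))
  where
  first : ∀ g w → map (unzip (suc n)) (fund w (gap g) (2 + n * 2)) ≡
          enum (suc n) (letters (next X g) w) (if strict X g w then 1 else 0)
  first g  []        = cong (_∷ []) (unzip-zeros (suc n))
  first g0 (g' ∷ w') = enum-fund (suc n) X (g' ∷ w')
  first g1 (g' ∷ w') = enum-fund (suc n) Y (g' ∷ w')
  -- A gap of 2 from x₁ leaves the pair x₁ , y₁, which `enum` records as a strict increase of the
  -- index.
  first g2 (g' ∷ w') = trans (map-unzip-0∷0∷ n (fund (g' ∷ w') 0 (n * 2)))
    (trans (cong (map cons0) (enum-fund n X (g' ∷ w'))) (sym (enum-shift n (letters X (g' ∷ w')) 0)))
enum-fund (suc n) Y (g ∷ w) = trans (cong (map (unzip (suc n))) (map-++ (0 ∷_) (map bump (fund w (gap g) _)) _))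
  (trans (map-++ (unzip (suc n)) (map (0 ∷_) (map bump (fund w (gap g) _))) _)
  (trans (cong₂ _++_ (trans (map-unzip-0∷bump n (fund w (gap g) _)) (cong (map (incL Y 0))
                       (trans (cong (map (unzip (suc n))) (sym (fund-suc w (gap g) _))) (first g w))))
                     (trans (map-unzip-0∷0∷ n (fund (g ∷ w) 1 (n * 2))) (cong (map cons0) (enum-fund n Y (g ∷ w)))))
         (sym (enum-suc n Y (strict Y g w) (letters (next Y g) w)))))
  where
  first : ∀ g w → map (unzip (suc n)) (fund w (suc (gap g)) (2 + n * 2)) ≡
          enum (suc n) (letters (next Y g) w) (if strict Y g w then 1 else 0)
  first g  []        = cong (_∷ []) (unzip-zeros (suc n))
  first g0 (g' ∷ w') = enum-fund (suc n) Y (g' ∷ w')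
  first g1 (g' ∷ w') = trans (map-unzip-0∷0∷ n (fund (g' ∷ w') 0 (n * 2)))
    (trans (cong (map cons0) (enum-fund n X (g' ∷ w'))) (sym (enum-shift n (letters X (g' ∷ w')) 0)))
  first g2 (g' ∷ w') = trans (map-unzip-0∷0∷ n (fund (g' ∷ w') 1 (n * 2)))
    (trans (cong (map cons0) (enum-fund n Y (g' ∷ w'))) (sym (enum-shift n (letters Y (g' ∷ w')) 0)))

-- Bicompositions and gap words

leading : ℕ → Letter
leading zero    = Y
leading (suc _) = X

NoConsecZeros-suc : ∀ b b' c → NoConsecZeros (suc b ∷ flatten c) → NoConsecZeros (suc b' ∷ flatten c)
NoConsecZeros-suc b b' []            _       = tt
NoConsecZeros-suc b b' ((_ , _) ∷ _) (_ , z) = (λ { (() , _) }) , z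

bicomposition→gaps : ∀ a b c → IsBicomposition ((a , b) ∷ c) →
  ∃ λ g → ∃ λ w → word ((a , b) ∷ c) ≡ letters (leading a) (g ∷ w)
bicomposition→gaps zero zero c (z , _) = ⊥-elim (z (refl , refl))
-- `g2` is a default value: `strict` marks the last letter `true` for every gap.
bicomposition→gaps zero (suc zero) [] _ = g2 , [] , refl
bicomposition→gaps zero (suc zero) ((zero , b) ∷ c) (_ , _ , z) with bicomposition→gaps zero b c z
... | g , w , eq = g2 , g ∷ w , cong ((Y , true) ∷_) eq
bicomposition→gaps zero (suc zero) ((suc a , b) ∷ c) (_ , _ , z) with bicomposition→gaps (suc a) b c z
... | g , w , eq = g1 , g ∷ w , cong ((Y , true) ∷_) eq
bicomposition→gaps zero (suc (suc b)) c (_ , z)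
  with bicomposition→gaps zero (suc b) c ((λ { (_ , ()) }) , NoConsecZeros-suc (suc b) b c z)
... | g , w , eq = g0 , g ∷ w , cong ((Y , false) ∷_) eq
bicomposition→gaps (suc zero) zero [] _ = g2 , [] , refl
-- A strict step from x to y would need a gap of 3; the two consecutive zeros of the bivector
-- exclude it.
bicomposition→gaps (suc zero) zero ((zero , b) ∷ c) (_ , z , _) = ⊥-elim (z (refl , refl))
bicomposition→gaps (suc zero) zero ((suc a , b) ∷ c) (_ , _ , z) with bicomposition→gaps (suc a) b c z
... | g , w , eq = g2 , g ∷ w , cong ((X , true) ∷_) eq
bicomposition→gaps (suc zero) (suc b) c (_ , z) with bicomposition→gaps zero (suc b) c ((λ { (_ , ()) }) , z)
... | g , w , eq = g1 , g ∷ w , cong ((X , false) ∷_) eq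
bicomposition→gaps (suc (suc a)) b c (_ , z) with bicomposition→gaps (suc a) b c ((λ { (() , _) }) , z)
... | g , w , eq = g0 , g ∷ w , cong ((X , false) ∷_) eq

bicomposition-word : ∀ c → IsBicomposition c → ∃ λ l → ∃ λ w → word c ≡ letters l w
bicomposition-word []            _ = X , [] , refl
bicomposition-word ((a , b) ∷ c) z with bicomposition→gaps a b c z
... | g , w , eq = leading a , g ∷ w , eq

block : Letter → ℕ → ℕ → ℕ × ℕ
block X a b = suc a , b
block Y a b = 0 , suc b

-- A new letter opens its own block if it is marked strict, and otherwise enlarges the first block
-- of the remaining word.
gaps→bicomposition : ∀ l g w → ∃ λ a → ∃ λ b → ∃ λ c →
  IsBicomposition (block l a b ∷ c) × word (block l a b ∷ c) ≡ letters l (g ∷ w)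
gaps→bicomposition X g [] = 0 , 0 , [] , ((λ { (() , _) }) , tt) , refl
gaps→bicomposition Y g [] = 0 , 0 , [] , ((λ { (_ , ()) }) , tt) , refl
gaps→bicomposition X g0 (g' ∷ w) with gaps→bicomposition X g' w
... | a , b , c , (_ , z) , eq = suc a , b , c , ((λ { (() , _) }) , z) , cong ((X , false) ∷_) eq
gaps→bicomposition X g1 (g' ∷ w) with gaps→bicomposition Y g' w
... | a , b , c , (_ , z) , eq = 0 , suc b , c , ((λ { (() , _) }) , z) , cong ((X , false) ∷_) eq
gaps→bicomposition X g2 (g' ∷ w) with gaps→bicomposition X g' w
... | a , b , c , z , eq = 0 , 0 , (suc a , b) ∷ c ,
  ((λ { (() , _) }) , (λ { (_ , ()) }) , z) , cong ((X , true) ∷_) eq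
gaps→bicomposition Y g0 (g' ∷ w) with gaps→bicomposition Y g' w
... | a , b , c , (_ , z) , eq = 0 , suc b , c ,
  ((λ { (_ , ()) }) , NoConsecZeros-suc b (suc b) c z) , cong ((Y , false) ∷_) eq
gaps→bicomposition Y g1 (g' ∷ w) with gaps→bicomposition X g' w
... | a , b , c , z , eq = 0 , 0 , (suc a , b) ∷ c ,
  ((λ { (_ , ()) }) , (λ { (() , _) }) , z) , cong ((Y , true) ∷_) eq
gaps→bicomposition Y g2 (g' ∷ w) with gaps→bicomposition Y g' w
... | a , b , c , z , eq = 0 , 0 , (0 , suc b) ∷ c ,
  ((λ { (_ , ()) }) , (λ { (() , _) }) , z) , cong ((Y , true) ∷_) eq

-- The quotient

coeff-++ : ∀ {n} (p q : Poly n) m → coeff (p +P q) m ≡ coeff p m ℚ.+ coeff q m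
coeff-++ []             q m = sym (ℚ.+-identityˡ _)
coeff-++ ((c , m') ∷ p) q m with m' ≟M m
... | yes _ = trans (cong (c ℚ.+_) (coeff-++ p q m)) (sym (ℚ.+-assoc c _ _))
... | no  _ = coeff-++ p q m

coeff-scale : ∀ {n} a (p : Poly n) m → coeff (scale a p) m ≡ a ℚ.* coeff p m
coeff-scale a []             m = sym (ℚ.*-zeroʳ a)
coeff-scale a ((c , m') ∷ p) m with m' ≟M m
... | yes _ = trans (cong (a ℚ.* c ℚ.+_) (coeff-scale a p m)) (sym (ℚ.*-distribˡ-+ a c _))
... | no  _ = coeff-scale a p m

coeff-sub : ∀ {n} (p q : Poly n) m → coeff (p -P q) m ≡ coeff p m ℚ.+ ℚ.- 1ℚ ℚ.* coeff q m
coeff-sub p q m = trans (coeff-++ p (scale (ℚ.- 1ℚ) q) m) (cong (coeff p m ℚ.+_) (coeff-scale (ℚ.- 1ℚ) q m))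

⟦_⟧ : ∀ {n} → Poly n → Coeffs (n * 2)
⟦_⟧ {n} p v = coeff p (unzip n v)

δ-refl : ∀ {m} (α : Vec ℕ m) → δ α α ≡ 1ℚ
δ-refl []          = refl
δ-refl (zero ∷ α)  = δ-refl α
δ-refl (suc a ∷ α) = δ-refl (a ∷ α)

δ-≢ : ∀ {m} (α v : Vec ℕ m) → α ≢ v → δ α v ≡ 0ℚ
δ-≢ []          []          ne = ⊥-elim (ne refl)
δ-≢ (zero ∷ α)  (zero ∷ v)  ne = δ-≢ α v (ne ∘ cong (0 ∷_))
δ-≢ (zero ∷ α)  (suc b ∷ v) ne = refl
δ-≢ (suc a ∷ α) (zero ∷ v)  ne = refl
δ-≢ (suc a ∷ α) (suc b ∷ v) ne = δ-≢ (a ∷ α) (b ∷ v) (ne ∘ cong bump)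

coeff-∷ : ∀ n c m (p : Poly n) v → ⟦ (c , m) ∷ p ⟧ v ≡ c ℚ.* δ (zip n m) v ℚ.+ ⟦ p ⟧ v
coeff-∷ n c m p v with m ≟M unzip n v
... | yes refl = cong (ℚ._+ ⟦ p ⟧ v) (sym (trans (cong (c ℚ.*_)
        (trans (cong (λ α → δ α v) (zip-unzip n v)) (δ-refl v))) (ℚ.*-identityʳ c)))
... | no  ne   = sym (trans (cong (ℚ._+ ⟦ p ⟧ v) (trans (cong (c ℚ.*_)
        (δ-≢ (zip n m) v (λ eq → ne (trans (sym (unzip-zip n m)) (cong (unzip n) eq))))) (ℚ.*-zeroʳ c)))
        (ℚ.+-identityˡ _))

≐⇒≈P : ∀ n (p q : Poly n) → ⟦ p ⟧ ≐ ⟦ q ⟧ → p ≈P q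
≐⇒≈P n p q e m = subst (λ m → coeff p m ≡ coeff q m) (unzip-zip n m) (e (zip n m))

times-0 : ∀ {m} (α : Vec ℕ m) → times α (λ _ → 0ℚ) ≐ (λ _ → 0ℚ)
times-0 []          []          = refl
times-0 (zero ∷ α)  (b ∷ v)     = times-0 α v
times-0 (suc a ∷ α) (zero ∷ v)  = refl
times-0 (suc a ∷ α) (suc b ∷ v) = times-0 (a ∷ α) (b ∷ v)

times-δ : ∀ {m} (α β : Vec ℕ m) → times α (δ β) ≐ δ (α +ᵥ β)
times-δ []          []          []          = refl
times-δ (zero ∷ α)  (b ∷ β)     (c ∷ v) with b ≡ᵇ c
... | true  = times-δ α β v
... | false = times-0 α v
times-δ (suc a ∷ α) (b ∷ β)     (zero ∷ v)  = refl
times-δ (suc a ∷ α) (b ∷ β)     (suc c ∷ v) = times-δ (a ∷ α) (b ∷ β) (c ∷ v)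

times-linear : ∀ {m} (α : Vec ℕ m) c f g →
  times α (λ v → c ℚ.* f v ℚ.+ g v) ≐ (λ v → c ℚ.* times α f v ℚ.+ times α g v)
times-linear []          c f g []          = refl
times-linear (zero ∷ α)  c f g (b ∷ v)     = times-linear α c (f ∘ (b ∷_)) (g ∘ (b ∷_)) v
times-linear (suc a ∷ α) c f g (zero ∷ v)  = sym (trans (ℚ.+-identityʳ _) (ℚ.*-zeroʳ c))
times-linear (suc a ∷ α) c f g (suc b ∷ v) = times-linear (a ∷ α) c f g (b ∷ v)

coeff-monomial-mul : ∀ n c m (s : Poly n) v →
  ⟦ map (λ t → c ℚ.* proj₁ t , mono-mul m (proj₂ t)) s ⟧ v ≡ c ℚ.* times (zip n m) ⟦ s ⟧ v
coeff-monomial-mul n c m []             v = sym (trans (cong (c ℚ.*_) (times-0 (zip n m) v)) (ℚ.*-zeroʳ c))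
coeff-monomial-mul n c m ((d , m') ∷ s) v = begin
    ⟦ (c ℚ.* d , mono-mul m m') ∷ rest ⟧ v
  ≡⟨ coeff-∷ n (c ℚ.* d) (mono-mul m m') rest v ⟩
    c ℚ.* d ℚ.* δ (zip n (mono-mul m m')) v ℚ.+ ⟦ rest ⟧ v
  ≡⟨ cong₂ (λ x y → c ℚ.* d ℚ.* x ℚ.+ y)
       (trans (cong (λ α → δ α v) (zip-mul n m m')) (sym (times-δ (zip n m) (zip n m') v)))
       (coeff-monomial-mul n c m s v) ⟩
    c ℚ.* d ℚ.* A ℚ.+ c ℚ.* B
  ≡⟨ cong (ℚ._+ c ℚ.* B) (ℚ.*-assoc c d A) ⟩
    c ℚ.* (d ℚ.* A) ℚ.+ c ℚ.* B
  ≡⟨ sym (ℚ.*-distribˡ-+ c (d ℚ.* A) B) ⟩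
    c ℚ.* (d ℚ.* A ℚ.+ B)
  ≡⟨ cong (c ℚ.*_) (sym (trans (times-cong (zip n m) (coeff-∷ n d m' s) v)
                              (times-linear (zip n m) d (δ (zip n m')) ⟦ s ⟧ v))) ⟩
    c ℚ.* times (zip n m) ⟦ (d , m') ∷ s ⟧ v ∎
  where
  open ≡-Reasoning
  rest = map (λ t → c ℚ.* proj₁ t , mono-mul m (proj₂ t)) s
  A = times (zip n m) (δ (zip n m')) v
  B = times (zip n m) ⟦ s ⟧ v

-- From `InIdeal` to `Ideal`, and closure properties of `InIdeal`

Ideal-cong : ∀ n {f g} → f ≐ g → Ideal n g → Ideal n f
Ideal-cong n e (none z)                = none (λ v → trans (e v) (z v))
Ideal-cong n e (plus c α s g σ s0 I z) = plus c α s g σ s0 I (λ v → trans (e v) (z v))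

Ideal-+ : ∀ n {f g} → Ideal n f → Ideal n g → Ideal n (λ v → f v ℚ.+ g v)
Ideal-+ n {f} {g} (none z) J = Ideal-cong n (λ v → trans (cong (ℚ._+ g v) (z v)) (ℚ.+-identityˡ _)) J
Ideal-+ n {f} {g} (plus c α s h σ s0 I z) J = plus c α s (λ v → h v ℚ.+ g v) σ s0 (Ideal-+ n I J)
  (λ v → trans (cong (ℚ._+ g v) (z v)) (ℚ.+-assoc (c ℚ.* times α s v) (h v) (g v)))

Quasi-cong : ∀ n {f g} → f ≐ g → Quasi n g → Quasi n f
Quasi-cong zero    e σ   = tt
Quasi-cong (suc n) e σ i = Symmetric-cong i e (σ i)

Quasi-linear : ∀ n c {f g} → Quasi n f → Quasi n g → Quasi n (λ v → c ℚ.* f v ℚ.+ g v)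
Quasi-linear zero    c σ τ   = tt
Quasi-linear (suc n) c σ τ i = Symmetric-linear i c (σ i) (τ i)

Quasi-0 : ∀ n → Quasi n (λ _ → 0ℚ)
Quasi-0 zero      = tt
Quasi-0 (suc n) i = Symmetric-0 i

embed : ∀ n → List (Vec ℕ (n * 2)) → Poly n
embed n p = map (λ v → 1ℚ , unzip n v) p

coeff-embed : ∀ n p → ⟦ embed n p ⟧ ≐ multiplicity p
coeff-embed n []      v = refl
coeff-embed n (α ∷ p) v = trans (coeff-∷ n 1ℚ (unzip n α) (embed n p) v)
  (cong₂ ℚ._+_ (trans (ℚ.*-identityˡ _) (cong (λ β → δ β v) (zip-unzip n α))) (coeff-embed n p v))

F-fund : ∀ n c l w → word c ≡ letters l w → F n c ≡ embed n (fund w (offset l) (n * 2))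
F-fund n c l w eq = trans (cong (map (1ℚ ,_)) (trans (cong (λ u → enum n u 0) eq) (sym (enum-fund n l w))))
  (sym (map-∘ (fund w (offset l) (n * 2))))

F-Quasi : ∀ n c → IsBicomposition c → Quasi n ⟦ F n c ⟧
F-Quasi zero    c z = tt
F-Quasi (suc n) c z with bicomposition-word c z
... | l , w , eq = Quasi-cong (suc n)
  (λ v → trans (cong (λ p → ⟦ p ⟧ v) (F-fund (suc n) c l w eq)) (coeff-embed (suc n) (fund w (offset l) _) v))
  (fundCoeff-QSym l w)

InQSymB⇒Quasi : ∀ n f → InQSymB n f → Quasi n ⟦ f ⟧
InQSymB⇒Quasi n f (lc , eq) = Quasi-cong n (λ v → eq (unzip n v)) (go lc)
  where
  go : ∀ lc → Quasi n ⟦ foldr (λ t acc → scale (proj₁ t) (F n (proj₁ (proj₂ t))) +P acc) 0P lc ⟧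
  go []                  = Quasi-0 n
  go ((a , c , z) ∷ lc) = Quasi-cong n
    (λ v → trans (coeff-++ (scale a (F n c)) _ (unzip n v))
                 (cong (ℚ._+ _) (coeff-scale a (F n c) (unzip n v))))
    (Quasi-linear n a (F-Quasi n c z) (go lc))

Ideal-mul : ∀ n (p s : Poly n) → Quasi n ⟦ s ⟧ → ⟦ s ⟧ zeros ≡ 0ℚ → Ideal n ⟦ p *P s ⟧
Ideal-mul n []            s σ s0 = none (λ _ → refl)
Ideal-mul n ((c , m) ∷ p) s σ s0 = plus c (zip n m) ⟦ s ⟧ ⟦ p *P s ⟧ σ s0 (Ideal-mul n p s σ s0)
  (λ v → trans (coeff-++ (map _ s) (p *P s) (unzip n v))
               (cong (ℚ._+ ⟦ p *P s ⟧ v) (coeff-monomial-mul n c m s v)))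

InIdeal⇒Ideal : ∀ n p → InIdeal n p → Ideal n ⟦ p ⟧
InIdeal⇒Ideal n p (gs , gen , eq) = Ideal-cong n (λ v → eq (unzip n v)) (go gs gen)
  where
  go : ∀ gs → All (λ t → Generator n (proj₂ t)) gs →
       Ideal n ⟦ foldr (λ t acc → (proj₁ t *P proj₂ t) +P acc) 0P gs ⟧
  go []             []                = none (λ _ → refl)
  go ((q , s) ∷ gs) ((σ , s0) ∷ gen) = Ideal-cong n (λ v → coeff-++ (q *P s) _ (unzip n v))
    (Ideal-+ n (Ideal-mul n q s (InQSymB⇒Quasi n s σ) (trans (cong (coeff s) (unzip-zeros n)) s0))
               (go gs gen))

InIdeal-cong : ∀ n (p q : Poly n) → ⟦ p ⟧ ≐ ⟦ q ⟧ → InIdeal n q → InIdeal n p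
InIdeal-cong n p q e (gs , gen , eq) = gs , gen , λ m → trans (≐⇒≈P n p q e m) (eq m)

InIdeal-0 : ∀ n → InIdeal n 0P
InIdeal-0 n = [] , [] , λ _ → refl

InIdeal-+ : ∀ n (p q : Poly n) → InIdeal n p → InIdeal n q → InIdeal n (p +P q)
InIdeal-+ n p q (gs , gen , eq) (gs' , gen' , eq') = gs ++ gs' , All.++⁺ gen gen' , λ m →
  trans (coeff-++ p q m) (trans (cong₂ ℚ._+_ (eq m) (eq' m)) (sym (go gs m)))
  where
  total : List (Poly n × Poly n) → Poly n
  total = foldr (λ t acc → (proj₁ t *P proj₂ t) +P acc) 0P
  go : ∀ gs m → coeff (total (gs ++ gs')) m ≡ coeff (total gs) m ℚ.+ coeff (total gs') m
  go []       m = sym (ℚ.+-identityˡ _)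
  go ((r , s) ∷ gs) m = trans (coeff-++ (r *P s) _ m) (trans (cong (coeff (r *P s) m ℚ.+_) (go gs m))
    (trans (sym (ℚ.+-assoc (coeff (r *P s) m) _ _))
           (cong (ℚ._+ coeff (total gs') m) (sym (coeff-++ (r *P s) (total gs) m)))))

scale-mul : ∀ {n} a (p s : Poly n) → scale a p *P s ≡ scale a (p *P s)
scale-mul a []            s = refl
scale-mul a ((c , m) ∷ p) s = trans
  (cong₂ _++_ (trans (map-cong (λ t → cong (_, mono-mul m (proj₂ t)) (ℚ.*-assoc a c (proj₁ t))) s) (map-∘ s))
              (scale-mul a p s))
  (sym (map-++ _ (map _ s) (p *P s)))

InIdeal-scale : ∀ n a (p : Poly n) → InIdeal n p → InIdeal n (scale a p)
InIdeal-scale n a p (gs , gen , eq) = map (λ t → scale a (proj₁ t) , proj₂ t) gs , All.map⁺ gen , λ m →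
  trans (coeff-scale a p m) (trans (cong (a ℚ.*_) (eq m)) (sym (go gs m)))
  where
  total : List (Poly n × Poly n) → Poly n
  total = foldr (λ t acc → (proj₁ t *P proj₂ t) +P acc) 0P
  go : ∀ gs m → coeff (total (map (λ t → scale a (proj₁ t) , proj₂ t) gs)) m ≡ a ℚ.* coeff (total gs) m
  go []             m = sym (ℚ.*-zeroʳ a)
  go ((r , s) ∷ gs) m = trans (coeff-++ (scale a r *P s) _ m) (trans (cong₂ ℚ._+_
    (trans (cong (λ p → coeff p m) (scale-mul a r s)) (coeff-scale a (r *P s) m)) (go gs m))
    (trans (sym (ℚ.*-distribˡ-+ a _ _)) (cong (a ℚ.*_) (sym (coeff-++ (r *P s) (total gs) m)))))

-- Linear combinations of monomials modulo the ideal

monomialBasis : ∀ n (L : List (Vec ℕ (n * 2))) → Vec (Poly n) (length L)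
monomialBasis n []      = []
monomialBasis n (α ∷ L) = embed n (α ∷ []) ∷ monomialBasis n L

comb : ∀ {m} (L : List (Vec ℕ m)) → Vec ℚ (length L) → Coeffs m
comb []      []       v = 0ℚ
comb (α ∷ L) (a ∷ as) v = a ℚ.* δ α v ℚ.+ comb L as v

coeff-lincomb : ∀ n L as → ⟦ lincomb as (monomialBasis n L) ⟧ ≐ comb L as
coeff-lincomb n []      []       v = refl
coeff-lincomb n (α ∷ L) (a ∷ as) v = trans (coeff-++ (scale a (embed n (α ∷ []))) _ (unzip n v))
  (cong₂ ℚ._+_ (trans (coeff-scale a (embed n (α ∷ [])) (unzip n v))
    (cong (a ℚ.*_) (trans (coeff-embed n (α ∷ []) v) (ℚ.+-identityʳ _)))) (coeff-lincomb n L as v))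

comb-outside : ∀ {m} (L : List (Vec ℕ m)) as v → All (_≢ v) L → comb L as v ≡ 0ℚ
comb-outside []      []       v []        = refl
comb-outside (α ∷ L) (a ∷ as) v (ne ∷ nes) = trans (cong₂ ℚ._+_
  (trans (cong (a ℚ.*_) (δ-≢ α v ne)) (ℚ.*-zeroʳ a)) (comb-outside L as v nes)) (ℚ.+-identityʳ _)

comb-injective : ∀ {m} (L : List (Vec ℕ m)) as → Unique L → comb L as ≐ (λ _ → 0ℚ) → as ≡ Vec.replicate _ 0ℚ
comb-injective []      []       _       e = refl
comb-injective (α ∷ L) (a ∷ as) (u ∷ us) e = cong₂ _∷_ a≡0 (comb-injective L as us
  (λ v → trans (sym (trans (cong (λ c → c ℚ.* δ α v ℚ.+ comb L as v) a≡0)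
    (trans (cong (ℚ._+ comb L as v) (ℚ.*-zeroˡ (δ α v))) (ℚ.+-identityˡ _)))) (e v)))
  where
  a≡0 : a ≡ 0ℚ
  a≡0 = trans (sym (trans (cong₂ ℚ._+_ (trans (cong (a ℚ.*_) (δ-refl α)) (ℚ.*-identityʳ a))
    (comb-outside L as α (All.map (λ ne eq → ne (sym eq)) u))) (ℚ.+-identityʳ a))) (e α)

comb-0 : ∀ {m} (L : List (Vec ℕ m)) v → comb L (Vec.replicate _ 0ℚ) v ≡ 0ℚ
comb-0 []      v = refl
comb-0 (α ∷ L) v = trans (cong₂ ℚ._+_ (ℚ.*-zeroˡ (δ α v)) (comb-0 L v)) (ℚ.+-identityʳ _)

comb-+ : ∀ {m} (L : List (Vec ℕ m)) as bs v →
  comb L (Vec.zipWith ℚ._+_ as bs) v ≡ comb L as v ℚ.+ comb L bs v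
comb-+ []      []       []       v = refl
comb-+ (α ∷ L) (a ∷ as) (b ∷ bs) v = trans (cong ((a ℚ.+ b) ℚ.* δ α v ℚ.+_) (comb-+ L as bs v))
  (solve 5 (λ a b d x y → (a :+ b) :* d :+ (x :+ y) := (a :* d :+ x) :+ (b :* d :+ y)) refl
    a b (δ α v) (comb L as v) (comb L bs v))

comb-scale : ∀ {m} (L : List (Vec ℕ m)) c as v → comb L (Vec.map (c ℚ.*_) as) v ≡ c ℚ.* comb L as v
comb-scale []      c []       v = sym (ℚ.*-zeroʳ c)
comb-scale (α ∷ L) c (a ∷ as) v = trans (cong (c ℚ.* a ℚ.* δ α v ℚ.+_) (comb-scale L c as v))
  (solve 4 (λ c a d x → c :* a :* d :+ c :* x := c :* (a :* d :+ x)) refl c a (δ α v) (comb L as v))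

comb-∈ : ∀ {m} (L : List (Vec ℕ m)) {α} → α ∈ L → ∃ λ as → comb L as ≐ δ α
comb-∈ (α ∷ L) (here refl) = 1ℚ ∷ Vec.replicate _ 0ℚ , λ v →
  trans (cong₂ ℚ._+_ (ℚ.*-identityˡ (δ α v)) (comb-0 L v)) (ℚ.+-identityʳ _)
comb-∈ (β ∷ L) (there α∈L) with comb-∈ L α∈L
... | as , e = 0ℚ ∷ as , λ v → trans (cong₂ ℚ._+_ (ℚ.*-zeroˡ (δ β v)) (e v)) (ℚ.+-identityˡ _)

module Span (n : ℕ) (L : List (Vec ℕ (n * 2))) where

  remainder : Poly n → Vec ℚ (length L) → Poly n
  remainder p as = p -P lincomb as (monomialBasis n L)

  Reducible : Poly n → Set
  Reducible p = ∃ λ as → InIdeal n (remainder p as)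

  coeff-remainder : ∀ p as v → ⟦ remainder p as ⟧ v ≡ ⟦ p ⟧ v ℚ.+ ℚ.- 1ℚ ℚ.* comb L as v
  coeff-remainder p as v = trans (coeff-sub p (lincomb as (monomialBasis n L)) (unzip n v))
    (cong (λ x → ⟦ p ⟧ v ℚ.+ ℚ.- 1ℚ ℚ.* x) (coeff-lincomb n L as v))

  reducible-cong : ∀ p q → ⟦ p ⟧ ≐ ⟦ q ⟧ → Reducible q → Reducible p
  reducible-cong p q e (as , I) = as , InIdeal-cong n (remainder p as) (remainder q as)
    (λ v → trans (coeff-remainder p as v)
      (trans (cong (ℚ._+ ℚ.- 1ℚ ℚ.* comb L as v) (e v)) (sym (coeff-remainder q as v)))) I

  reducible-ideal : ∀ p → InIdeal n p → Reducible p
  reducible-ideal p I = 0s , InIdeal-cong n (remainder p 0s) p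
    (λ v → trans (coeff-remainder p 0s v)
      (trans (cong (λ x → ⟦ p ⟧ v ℚ.+ ℚ.- 1ℚ ℚ.* x) (comb-0 L v)) (ℚ.+-identityʳ (⟦ p ⟧ v)))) I
    where 0s = Vec.replicate (length L) 0ℚ

  reducible-∈ : ∀ α → α ∈ L → Reducible (embed n (α ∷ []))
  reducible-∈ α α∈L with comb-∈ L α∈L
  ... | as , e = as , InIdeal-cong n (remainder (embed n (α ∷ [])) as) 0P (λ v → begin
      ⟦ remainder (embed n (α ∷ [])) as ⟧ v
    ≡⟨ coeff-remainder (embed n (α ∷ [])) as v ⟩
      ⟦ embed n (α ∷ []) ⟧ v ℚ.+ ℚ.- 1ℚ ℚ.* comb L as v
    ≡⟨ cong₂ (λ x y → x ℚ.+ ℚ.- 1ℚ ℚ.* y) (coeff-embed n (α ∷ []) v) (e v) ⟩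
      (δ α v ℚ.+ 0ℚ) ℚ.+ ℚ.- 1ℚ ℚ.* δ α v
    ≡⟨ solve 1 (λ x → (x :+ con 0ℚ) :+ (:- con 1ℚ) :* x := con 0ℚ) refl (δ α v) ⟩
      0ℚ ∎) (InIdeal-0 n)
    where open ≡-Reasoning

  reducible-+ : ∀ p q → Reducible p → Reducible q → Reducible (p +P q)
  reducible-+ p q (as , I) (bs , J) = cs , InIdeal-cong n
    (remainder (p +P q) cs) (remainder p as +P remainder q bs) (λ v → begin
      ⟦ remainder (p +P q) cs ⟧ v
    ≡⟨ coeff-remainder (p +P q) cs v ⟩
      ⟦ p +P q ⟧ v ℚ.+ ℚ.- 1ℚ ℚ.* comb L cs v
    ≡⟨ cong₂ (λ x y → x ℚ.+ ℚ.- 1ℚ ℚ.* y) (coeff-++ p q (unzip n v)) (comb-+ L as bs v) ⟩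
      (⟦ p ⟧ v ℚ.+ ⟦ q ⟧ v) ℚ.+ ℚ.- 1ℚ ℚ.* (comb L as v ℚ.+ comb L bs v)
    ≡⟨ solve 4 (λ x y a b → (x :+ y) :+ (:- con 1ℚ) :* (a :+ b) :=
                            (x :+ (:- con 1ℚ) :* a) :+ (y :+ (:- con 1ℚ) :* b)) refl
         (⟦ p ⟧ v) (⟦ q ⟧ v) (comb L as v) (comb L bs v) ⟩
      (⟦ p ⟧ v ℚ.+ ℚ.- 1ℚ ℚ.* comb L as v) ℚ.+ (⟦ q ⟧ v ℚ.+ ℚ.- 1ℚ ℚ.* comb L bs v)
    ≡⟨ sym (cong₂ ℚ._+_ (coeff-remainder p as v) (coeff-remainder q bs v)) ⟩
      ⟦ remainder p as ⟧ v ℚ.+ ⟦ remainder q bs ⟧ v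
    ≡⟨ sym (coeff-++ (remainder p as) (remainder q bs) (unzip n v)) ⟩
      ⟦ remainder p as +P remainder q bs ⟧ v ∎)
    (InIdeal-+ n (remainder p as) (remainder q bs) I J)
    where
    open ≡-Reasoning
    cs = Vec.zipWith ℚ._+_ as bs

  reducible-scale : ∀ c p → Reducible p → Reducible (scale c p)
  reducible-scale c p (as , I) = cs , InIdeal-cong n
    (remainder (scale c p) cs) (scale c (remainder p as)) (λ v → begin
      ⟦ remainder (scale c p) cs ⟧ v
    ≡⟨ coeff-remainder (scale c p) cs v ⟩
      ⟦ scale c p ⟧ v ℚ.+ ℚ.- 1ℚ ℚ.* comb L cs v
    ≡⟨ cong₂ (λ x y → x ℚ.+ ℚ.- 1ℚ ℚ.* y) (coeff-scale c p (unzip n v)) (comb-scale L c as v) ⟩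
      c ℚ.* ⟦ p ⟧ v ℚ.+ ℚ.- 1ℚ ℚ.* (c ℚ.* comb L as v)
    ≡⟨ solve 3 (λ c x a → c :* x :+ (:- con 1ℚ) :* (c :* a) := c :* (x :+ (:- con 1ℚ) :* a)) refl
         c (⟦ p ⟧ v) (comb L as v) ⟩
      c ℚ.* (⟦ p ⟧ v ℚ.+ ℚ.- 1ℚ ℚ.* comb L as v)
    ≡⟨ sym (cong (c ℚ.*_) (coeff-remainder p as v)) ⟩
      c ℚ.* ⟦ remainder p as ⟧ v
    ≡⟨ sym (coeff-scale c (remainder p as) (unzip n v)) ⟩
      ⟦ scale c (remainder p as) ⟧ v ∎)
    (InIdeal-scale n c (remainder p as) I)
    where
    open ≡-Reasoning
    cs = Vec.map (c ℚ.*_) as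

  additive : Additive (Reducible ∘ embed n)
  additive = record
    { nil     = reducible-ideal [] (InIdeal-0 n)
    ; add     = λ p q P Q → subst Reducible (sym (map-++ _ p q)) (reducible-+ (embed n p) (embed n q) P Q)
    ; cancelˡ = λ p q PQ P → subtract q (p ++ q) p (λ v →
        trans (solve 2 (λ x y → y := (x :+ y) :+ (:- con 1ℚ) :* x) refl (⟦ embed n p ⟧ v) (⟦ embed n q ⟧ v))
              (join p q (⟦ embed n p ⟧ v) v)) PQ P
    ; cancelʳ = λ p q PQ Q → subtract p (p ++ q) q (λ v →
        trans (solve 2 (λ x y → x := (x :+ y) :+ (:- con 1ℚ) :* y) refl (⟦ embed n p ⟧ v) (⟦ embed n q ⟧ v))
              (join p q (⟦ embed n q ⟧ v) v)) PQ Q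
    }
    where
    join : ∀ p q x v → (⟦ embed n p ⟧ v ℚ.+ ⟦ embed n q ⟧ v) ℚ.+ ℚ.- 1ℚ ℚ.* x ≡
                       ⟦ embed n (p ++ q) ⟧ v ℚ.+ ℚ.- 1ℚ ℚ.* x
    join p q x v = cong (ℚ._+ ℚ.- 1ℚ ℚ.* x) (sym (trans (cong (λ r → ⟦ r ⟧ v) (map-++ _ p q))
      (coeff-++ (embed n p) (embed n q) (unzip n v))))
    subtract : ∀ p q r → (∀ v → ⟦ embed n p ⟧ v ≡ ⟦ embed n q ⟧ v ℚ.+ ℚ.- 1ℚ ℚ.* ⟦ embed n r ⟧ v) →
               Reducible (embed n q) → Reducible (embed n r) → Reducible (embed n p)
    subtract p q r e Q R = reducible-cong (embed n p) (embed n q -P embed n r)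
      (λ v → trans (e v) (sym (coeff-sub (embed n q) (embed n r) (unzip n v))))
      (reducible-+ (embed n q) (scale (ℚ.- 1ℚ) (embed n r)) Q (reducible-scale (ℚ.- 1ℚ) (embed n r) R))

  reducible-all : (∀ α → Reducible (embed n (α ∷ []))) → ∀ p → Reducible p
  reducible-all R []            = reducible-ideal [] (InIdeal-0 n)
  reducible-all R ((c , m) ∷ p) = reducible-+ ((c , m) ∷ []) p
    (subst Reducible (cong (_∷ []) (cong₂ _,_ (ℚ.*-identityʳ c) (unzip-zip n m)))
      (reducible-scale c (embed n (zip n m ∷ [])) (R (zip n m)))) (reducible-all R p)

F-Generator : ∀ n l g w c → IsBicomposition c → word c ≡ letters l (g ∷ w) → Generator n (F n c)
F-Generator n l g w c z eq =
  ((1ℚ , c , z) ∷ [] , λ m → sym (trans (coeff-++ (scale 1ℚ (F n c)) [] m) (trans (ℚ.+-identityʳ _)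
    (trans (coeff-scale 1ℚ (F n c) m) (ℚ.*-identityˡ _))))) ,
  (trans (cong (coeff (F n c)) (sym (unzip-zeros n)))
    (trans (cong (λ p → ⟦ p ⟧ zeros) (F-fund n c l (g ∷ w) eq))
    (trans (coeff-embed n (fund (g ∷ w) (offset l) _) zeros) (fundCoeff-constant (n * 2) g w (offset l)))))

embed-shift : ∀ n α p → embed n (map (α +ᵥ_) p) ≡
  map (λ t → 1ℚ ℚ.* proj₁ t , mono-mul (unzip n α) (proj₂ t)) (embed n p)
embed-shift n α []      = refl
embed-shift n α (β ∷ p) = cong₂ _∷_ (cong (1ℚ ,_) (unzip-+ n α β)) (embed-shift n α p)

-- The nonempty word comes from a bicomposition whose polynomial is a generator; its cofactor is the
-- single monomial z^α.
InIdeal-fund : ∀ n α l g w → InIdeal n (embed n (map (α +ᵥ_) (fund (g ∷ w) (offset l) (n * 2))))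
InIdeal-fund n α l g w with gaps→bicomposition l g w
... | a , b , c , z , eq = (embed n (α ∷ []) , F n (block l a b ∷ c)) ∷ [] , F-Generator n l g w _ z eq ∷ [] ,
  λ m → cong (λ p → coeff p m) (trans (embed-shift n α (fund (g ∷ w) (offset l) (n * 2)))
    (trans (cong (map _) (sym (F-fund n (block l a b ∷ c) l (g ∷ w) eq)))
      (sym (trans (++-identityʳ _) (++-identityʳ _)))))

-- The Dyck vectors index a basis

bump-injective : ∀ {m} {u v : Vec ℕ (suc m)} → bump u ≡ bump v → u ≡ v
bump-injective {u = _ ∷ _} {v = _ ∷ _} refl = refl

0∷-injective : ∀ {m} {u v : Vec ℕ m} → (0 ∷ u) ≡ (0 ∷ v) → u ≡ v
0∷-injective refl = refl

dyckVectors-unique : ∀ m h → Unique (dyckVectors m h)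
dyckVectors-unique zero    h             = [] ∷ []
dyckVectors-unique (suc m) zero          = Unique.map⁺ 0∷-injective (dyckVectors-unique m 1)
dyckVectors-unique (suc m) (suc zero)    = Unique.map⁺ 0∷-injective (dyckVectors-unique m 2)
dyckVectors-unique (suc m) (suc (suc h)) = Unique.++⁺
  (Unique.map⁺ 0∷-injective (dyckVectors-unique m (3 + h)))
  (Unique.map⁺ bump-injective (dyckVectors-unique (suc m) h))
  λ { (u∈ , v∈) → disjoint (∈-map⁻ (0 ∷_) u∈) (∈-map⁻ bump v∈) }
  where
  disjoint : ∀ {x} → (∃ λ u → u ∈ dyckVectors m (3 + h) × x ≡ 0 ∷ u) →
             (∃ λ v → v ∈ dyckVectors (suc m) h × x ≡ bump v) → ⊥
  disjoint (u , _ , refl) ((_ ∷ _) , _ , ())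

dyckVectors-sound : ∀ m h → All (Dyck h) (dyckVectors m h)
dyckVectors-sound zero    h             = tt ∷ []
dyckVectors-sound (suc m) zero          = All.map⁺ (dyckVectors-sound m 1)
dyckVectors-sound (suc m) (suc zero)    = All.map⁺ (dyckVectors-sound m 2)
dyckVectors-sound (suc m) (suc (suc h)) = All.++⁺ (All.map⁺ (dyckVectors-sound m (3 + h)))
  (All.map⁺ (All.map (λ { {_ ∷ _} d → d }) (dyckVectors-sound (suc m) h)))

dyckVectors-complete : ∀ m h v → Dyck h v → v ∈ dyckVectors m h
dyckVectors-complete zero    h             []          d = here refl
dyckVectors-complete (suc m) zero          (zero ∷ v)  d = ∈-map⁺ (0 ∷_) (dyckVectors-complete m 1 v d)
dyckVectors-complete (suc m) (suc zero)    (zero ∷ v)  d = ∈-map⁺ (0 ∷_) (dyckVectors-complete m 2 v d)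
dyckVectors-complete (suc m) (suc (suc h)) (zero ∷ v)  d =
  ∈-++⁺ˡ (∈-map⁺ (0 ∷_) (dyckVectors-complete m (3 + h) v d))
dyckVectors-complete (suc m) (suc (suc h)) (suc e ∷ v) d =
  ∈-++⁺ʳ (map (0 ∷_) (dyckVectors m (3 + h))) (∈-map⁺ bump (dyckVectors-complete (suc m) h (e ∷ v) d))

quotientDim : ∀ n → QuotientDim n (length (dyckVectors (n * 2) 0))
quotientDim n = monomialBasis n L , independent , reducible-all spanning
  where
  L = dyckVectors (n * 2) 0
  open Span n L

  independent : ∀ as → InIdeal n (lincomb as (monomialBasis n L)) → as ≡ Vec.replicate _ 0ℚ
  independent as I = comb-injective L as (dyckVectors-unique (n * 2) 0)
    (Ideal-Dyck n (comb L as)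
      (Ideal-cong n (λ v → sym (coeff-lincomb n L as v)) (InIdeal⇒Ideal n (lincomb as (monomialBasis n L)) I))
      (λ v ¬d → comb-outside L as v
        (All.map (λ d eq → ¬d (subst (Dyck 0) eq d)) (dyckVectors-sound (n * 2) 0))))

  contains : ContainsFund 1 (Reducible ∘ embed n)
  -- The weight is at least 1, which excludes the empty word and with it the constant polynomial 1.
  contains α (g ∷ w) g0 _ _ = reducible-ideal (embed n (map (α +ᵥ_) (fund (g ∷ w) 0 (n * 2))))
    (InIdeal-fund n α X g w)
  contains α (g ∷ w) g1 _ _ = reducible-ideal (embed n (map (α +ᵥ_) (fund (g ∷ w) 1 (n * 2))))
    (InIdeal-fund n α Y g w)
  contains α _       g2 (s≤s ()) _

  spanning : ∀ α → Reducible (embed n (α ∷ []))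
  spanning = reduce (n * 2) 0 (Reducible ∘ embed n) additive contains
    (λ v d → reducible-∈ v (dyckVectors-complete (n * 2) 0 v d))

theorem1 : (n : ℕ) → 1 ≤ n → QuotientDim n (((3 * n) C n) / suc (2 * n))
theorem1 n _ = subst (QuotientDim n) (length-dyckVectors-ternary n) (quotientDim n)
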